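{- Let $G$ be a bipartite graph with $m$ left vertices and $n$ right vertices, and let $G^*$ be the bipartite graph obtained from $G$ by swapping its left and right vertex sets. Write $Q_G:=Q_G(1,\dots,1)\subset\mathbb R^n$ and $Q_{G^*}:=Q_{G^*}(1,\dots,1)\subset\mathbb R^m$. Then $$|Q_G\cap\mathbb Z^n|=|Q_{G^*}\cap\mathbb Z^m|.$$ More strongly, the two polytopes have the same distribution of the number of nonzero coordinates of lattice points: $$\sum_{\boldsymbol x\in Q_G\cap\mathbb Z^n}u^{s(\boldsymbol x)}=\sum_{\boldsymbol y\in Q_{G^*}\cap\mathbb Z^m}u^{s(\boldsymbol y)}.$$
   Context: For a bipartite graph $G$ with left vertices $\ell_1,\dots,\ell_m$ and right vertices $r_1,\dots,r_n$, let $I_j=\{i\in[n]\mid\ell_j\text{ is adjacent to }r_i\}$ for $j\in[m]$. For nonempty $I\subset[n]$, $\diamondsuit_I=\operatorname{conv}(\pm\boldsymbol e_i\mid i\in I)\subset\mathbb R^n$ is the cross polytope, and $\diamondsuit_\varnothing=\{\boldsymbol 0\}$. $Q_G(k_1,\dots,k_m)=k_1\diamondsuit_{I_1}+\cdots+k_m\diamondsuit_{I_m}$ (Minkowski sum). For an integer vector $\boldsymbol x$, $s(\boldsymbol x)$ is the number of nonzero coordinates of $\boldsymbol x$; $u$ is an indeterminate. -}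

module Defs where

open import Level using (_⊔_; suc; 0ℓ)
open import Algebra.Apartness.Bundles using (HeytingField)
open import Algebra.Bundles using (CommutativeRing)
import Algebra.Definitions.RawMonoid as RawMonoidDefs
open import Data.Bool.Base using (Bool; if_then_else_)
open import Data.Fin.Base using (Fin)
open import Data.Fin.Properties using () renaming (_≟_ to _≟ᶠ_)
open import Data.Fin.Subset using (Subset; Nonempty; Empty) renaming (_∈_ to _∈ˢ_)
open import Data.Integer.Base using (ℤ; +_; -[1+_]; 0ℤ)
open import Data.Integer.Properties using () renaming (_≟_ to _≟ᶻ_)
open import Data.List.Base using (List; []; _∷_; _++_; replicate; map; foldr; length)
open import Data.List.Membership.Propositional using () renaming (_∈_ to _∈ˡ_)
open import Data.List.Relation.Unary.All using (All)
open import Data.List.Relation.Unary.Unique.Propositional using (Unique)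
open import Data.Nat.Base as ℕ using (ℕ; zero)
open import Data.Product.Base using (Σ-syntax; ∃-syntax; _×_; _,_)
open import Data.Rational.Base as ℚ using (ℚ)
import Data.Rational.Properties as ℚ
open import Data.Sum.Base using (_⊎_; inj₁; inj₂)
open import Data.Vec.Base as Vec using (Vec)
open import Data.Vec.Functional using (Vector)
open import Relation.Binary.Core using (Rel)
open import Relation.Binary.Definitions using (tri<; tri≈; tri>)
open import Relation.Binary.PropositionalEquality.Core using (_≡_)
open import Relation.Binary.Structures using (IsStrictPartialOrder)
open import Relation.Nullary.Decidable.Core using (does; ¬?)
open import Relation.Nullary.Negation.Core using (¬_; contradiction)
open import Relation.Unary using (Pred; _∈_)

-- The library has no real numbers, so polytopes live in Kⁿ for an arbitrary
-- ordered field K.  The axioms are the constructive ones (cotransitivity and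
-- tightness of _<_ follow from those of _#_ ; 0 < 1 follows from
-- invertibility), so that decidability of _<_ is not required: ℚ, the
-- classical reals and the constructive reals are all instances.
record OrderedField c ℓ₁ ℓ₂ ℓ₃ : Set (suc (c ⊔ ℓ₁ ⊔ ℓ₂ ⊔ ℓ₃)) where
  infix 4 _<_ _≤_
  field
    heytingField : HeytingField c ℓ₁ ℓ₂

  open HeytingField heytingField public

  field
    _<_                  : Rel Carrier ℓ₃
    isStrictPartialOrder : IsStrictPartialOrder _≈_ _<_
    #⇒<⊎>                : ∀ {x y} → x # y → x < y ⊎ y < x
    <⇒#                  : ∀ {x y} → x < y → x # y
    +-monoˡ-<            : ∀ z {x y} → x < y → x + z < y + z
    *-pos                : ∀ {x y} → 0# < x → 0# < y → 0# < x * y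

  _≤_ : Rel Carrier ℓ₃
  x ≤ y = ¬ (y < x)

  commutativeRing : CommutativeRing c ℓ₁
  commutativeRing = record { isCommutativeRing = isCommutativeRing }

ℚ-orderedField : OrderedField 0ℓ 0ℓ 0ℓ 0ℓ
ℚ-orderedField = record
  { heytingField         = ℚ.heytingField
  ; _<_                  = ℚ._<_
  ; isStrictPartialOrder = ℚ.<-isStrictPartialOrder
  ; #⇒<⊎>                = connex
  ; <⇒#                  = λ p<q p≡q → ℚ.<-irrefl p≡q p<q
  ; +-monoˡ-<            = ℚ.+-monoˡ-<
  ; *-pos                = pos
  }
  where
  connex : ∀ {p q} → ¬ (p ≡ q) → p ℚ.< q ⊎ q ℚ.< p
  connex {p} {q} p≢q with ℚ.<-cmp p q
  ... | tri< p<q _ _ = inj₁ p<q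
  ... | tri≈ _ p≡q _ = contradiction p≡q p≢q
  ... | tri> _ _ q<p = inj₂ q<p

  pos : ∀ {p q} → ℚ.0ℚ ℚ.< p → ℚ.0ℚ ℚ.< q → ℚ.0ℚ ℚ.< p ℚ.* q
  pos {p} {q} 0<p 0<q = ℚ.positive⁻¹ (p ℚ.* q)
    where
    instance
      _ = ℚ.pos*pos⇒pos p {{ℚ.positive 0<p}} q {{ℚ.positive 0<q}}

record BipartiteGraph (m n : ℕ) : Set where
  field
    adjacent : Fin m → Fin n → Bool

open BipartiteGraph public

swap : ∀ {m n} → BipartiteGraph m n → BipartiteGraph n m
swap G .adjacent i j = G .adjacent j i

I[_] : ∀ {m n} → BipartiteGraph m n → Fin m → Subset n
I[ G ] j = Vec.tabulate (G .adjacent j)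

module Polytopes {c ℓ₁ ℓ₂ ℓ₃} (K : OrderedField c ℓ₁ ℓ₂ ℓ₃) where

  open OrderedField K
  open RawMonoidDefs (CommutativeRing.+-rawMonoid commutativeRing) public
    using (sum) renaming (_×_ to _⋆_)

  Point : ℕ → Set c
  Point n = Vector Carrier n

  infix 4 _≋_
  _≋_ : ∀ {n} → Rel (Point n) ℓ₁
  x ≋ y = ∀ i → x i ≈ y i

  𝟎 : ∀ {n} → Point n
  𝟎 _ = 0#

  e : ∀ {n} → Fin n → Point n
  e i i′ = if does (i ≟ᶠ i′) then 1# else 0#

  -e : ∀ {n} → Fin n → Point n
  -e i i′ = - e i i′

  conv : ∀ {n ℓ} → Pred (Point n) ℓ → Pred (Point n) (c ⊔ ℓ₁ ⊔ ℓ₃ ⊔ ℓ)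
  conv {n} S x =
    ∃[ r ] Σ[ p ∈ (Fin r → Point n) ] Σ[ w ∈ (Fin r → Carrier) ]
      (∀ t → p t ∈ S) ×
      (∀ t → 0# ≤ w t) ×
      (sum w ≈ 1#) ×
      (x ≋ λ i → sum (λ t → w t * p t i))

  ±e : ∀ {n} → Subset n → Pred (Point n) ℓ₁
  ±e I v = ∃[ i ] (i ∈ˢ I) × (v ≋ e i ⊎ v ≋ -e i)

  ◇ : ∀ {n} → Subset n → Pred (Point n) (c ⊔ ℓ₁ ⊔ ℓ₃)
  ◇ I x = (Nonempty I × x ∈ conv (±e I)) ⊎ (Empty I × x ≋ 𝟎)

  dilate : ∀ {n ℓ} → ℕ → Pred (Point n) ℓ → Pred (Point n) (c ⊔ ℓ₁ ⊔ ℓ)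
  dilate k A x = ∃[ a ] (a ∈ A) × (x ≋ λ i → k ⋆ a i)

  -- The empty Minkowski sum is { 0 }.
  minkowskiSum : ∀ {m n ℓ} → (Fin m → Pred (Point n) ℓ) → Pred (Point n) (c ⊔ ℓ₁ ⊔ ℓ)
  minkowskiSum {m} {n} A x =
    Σ[ a ∈ (Fin m → Point n) ]
      (∀ j → a j ∈ A j) × (x ≋ λ i → sum (λ j → a j i))

  Q[_] : ∀ {m n} → BipartiteGraph m n → (Fin m → ℕ) → Pred (Point n) (c ⊔ ℓ₁ ⊔ ℓ₃)
  Q[ G ] k = minkowskiSum (λ j → dilate (k j) (◇ (I[ G ] j)))

  Q : ∀ {m n} → BipartiteGraph m n → Pred (Point n) (c ⊔ ℓ₁ ⊔ ℓ₃)
  Q G = Q[ G ] (λ _ → 1)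

  fromℤ : ℤ → Carrier
  fromℤ (+ k)    = k ⋆ 1#
  fromℤ -[1+ k ] = - (ℕ.suc k ⋆ 1#)

  infix 5 _∩ℤ
  _∩ℤ : ∀ {n ℓ} → Pred (Point n) ℓ → Pred (Vec ℤ n) ℓ
  (A ∩ℤ) x = (λ i → fromℤ (Vec.lookup x i)) ∈ A

-- A repetition-free list of exactly the elements satisfying P.  Any two
-- enumerations of P are permutations of each other, so ∣_∣ and Σu^ below
-- depend only on P.
record Enumeration {a p} {A : Set a} (P : Pred A p) : Set (a ⊔ p) where
  field
    elements : List A
    unique   : Unique elements
    sound    : All P elements
    complete : ∀ {x} → P x → x ∈ˡ elements

open Enumeration public

∣_∣ : ∀ {a p} {A : Set a} {P : Pred A p} → Enumeration P → ℕ
∣ E ∣ = length (E .elements)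

-- ℕ[u], as coefficient lists with the constant coefficient first; trailing
-- zeros are immaterial for _≈ₚ_.
Poly : Set
Poly = List ℕ

coeff : Poly → ℕ → ℕ
coeff []      _         = 0
coeff (a ∷ f) zero      = a
coeff (a ∷ f) (ℕ.suc k) = coeff f k

infix 4 _≈ₚ_
_≈ₚ_ : Rel Poly 0ℓ
f ≈ₚ g = ∀ k → coeff f k ≡ coeff g k

infixl 6 _+ₚ_
_+ₚ_ : Poly → Poly → Poly
[]      +ₚ g       = g
(a ∷ f) +ₚ []      = a ∷ f
(a ∷ f) +ₚ (b ∷ g) = (a ℕ.+ b) ∷ (f +ₚ g)

u^ : ℕ → Poly
u^ k = replicate k 0 ++ 1 ∷ []

s : ∀ {n} → Vec ℤ n → ℕ
s = Vec.count (λ z → ¬? (z ≟ᶻ 0ℤ))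

Σu^ : ∀ {a p} {A : Set a} {P : Pred A p} → (A → ℕ) → Enumeration P → Poly
Σu^ f E = foldr _+ₚ_ [] (map (λ x → u^ (f x)) (E .elements))

{-# OPTIONS --safe #-}

-- An integer point x lies in Q_G iff |x| satisfies Hall's condition
-- Σ_{i ∈ S} |xᵢ| ≤ |N(S)| for all S ⊆ [n]: pair x with the sign vector of x on
-- S for one direction, and peel off one left vertex at a time for the other.
-- A Hall vector d comes from 2^|supp d| points, so it suffices to see that the
-- Hall vectors with support A are equinumerous with the T ⊆ [m] that can be
-- perfectly matched with A: the matchable pairs (A , T) are symmetric in G and
-- G*.
--
-- Write N(H,A) for either count in the family H of left neighbourhoods, and
-- g(H,A,R) for the number of vectors with support A (respectively of T with
-- |T| = |A| - 1) whose largest excess over Hall's condition is exactly 1 and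
-- for which R is the least set attaining it.  In both cases
--   N(I ∷ H, A)  = N(H,A) + Σ_{R ∩ I ≠ ∅} g(H,A,R),
--   g(H,A,R)     = g(H,R,R) N(H ∖∖ R, A ∖ R),
--   N(H,A ∖ {i}) = Σ_{R ∋ i} g(H,A,R)   for i ∈ A.
-- By induction on |A| the last identity determines g(H,A,A), all other terms
-- being known, and then the first one determines N(H,A).
module Submission where

open import Defs
open import Data.Nat.Base using (ℕ)
open import Data.Product.Base using (Σ-syntax; _×_; _,_)
open import Relation.Binary.PropositionalEquality.Core using (_≡_)

-- The two counts vary opposite arguments of one relation between a set function `ρ` and a vector
-- `d`. Demands fix `ρ = cover H ⊤` and let `d` run; transversals fix `d = 𝟙 A` and let `T` run in
-- `ρ = cover H T`. This is why the facts about excess are proved for an arbitrary monotone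
-- submodular `ρ` and an arbitrary `d`. Submodularity provides a least set of excess one. Being
-- determined by `ρ` and `d`, it can index a sum without counting anything twice. No bijection
-- between the demands and the transversals of a fixed `A` is constructed. Adding a left vertex,
-- splitting along `R` and deleting a point are bijective within each count, and the two counts are
-- compared only through the numerical identities that result.

module Combinatorics where

  open import Data.Nat.Properties
  open import Algebra.Properties.CommutativeSemigroup +-commutativeSemigroup using (interchange; x∙yz≈y∙xz)
  open import Data.Bool.Base using (Bool; true; false; if_then_else_; _∧_; _∨_; not)
  open import Data.Bool.Properties using (∧-identityʳ; ∨-identityʳ; ∨-zeroʳ) renaming (_≟_ to _≟ᵇ_)
  open import Data.Fin.Base using (Fin; zero; suc)
  open import Data.Fin.Subset
    using (Subset; ⊥; ⊤; ⁅_⁆; _∩_; _∪_; ∁; _∈_; _∉_; _⊆_; _⊈_; Nonempty)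
    renaming (∣_∣ to ∥_∥)
  open import Data.Fin.Subset.Properties
  open import Data.Integer.Base as ℤ using (ℤ; -[1+_]; 0ℤ)
  open import Data.Integer.Properties using (∣i∣≡0⇒i≡0)
  open import Data.List.Base as List using (List; []; _∷_; _++_; length; filter; foldr; upTo)
  open import Data.List.Membership.Propositional using () renaming (_∈_ to _∈ˡ_)
  open import Data.List.Membership.Propositional.Properties
    using (∈-∃++; ∈-++⁻; ∈-++⁺ˡ; ∈-++⁺ʳ; ∈-map⁺; ∈-map⁻; ∈-filter⁺; ∈-filter⁻; ∈-upTo⁺; ∈-upTo⁻)
  open import Data.List.Properties using (length-++; length-map; filter-accept; filter-reject)
  open import Data.List.Relation.Unary.All as All using ([]; _∷_)
  open import Data.List.Relation.Unary.AllPairs using ([]; _∷_)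
  open import Data.List.Relation.Unary.Any using (here; there)
  open import Data.List.Relation.Unary.Unique.Propositional using (Unique)
  import Data.List.Relation.Unary.Unique.Propositional.Properties as Unique
  open import Data.Nat.Base using (ℕ; zero; suc; _+_; _*_; _^_; _≤_; _<_; z≤n; s≤s; s≤s⁻¹; z<s)
  open import Data.Nat.ListAction using (sum)
  open import Data.Product.Base as × using (∃-syntax; _×_; _,_; proj₁; proj₂)
  open import Data.Product.Properties using (,-injectiveˡ; ,-injectiveʳ)
  open import Data.Sum.Base using (_⊎_; inj₁; inj₂; [_,_]′)
  open import Data.Sum.Properties using (inj₁-injective; inj₂-injective)
  open import Data.Vec.Base as Vec using (Vec; []; _∷_; here; there; zipWith; lookup; _[_]≔_)
  open import Data.Vec.Properties
    using (≡-dec; ∷-injective; count≤n; lookup-map; lookup∘tabulate; lookup∘updateAt; lookup⇒[]=; []=⇒lookup)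
  open import Data.Vec.Relation.Unary.All as VAll using ([]; _∷_)
  open import Data.Vec.Relation.Unary.All.Properties using (lookup⁻)
  open import Function.Base using (_∘_; id; case_of_)
  open import Level using (Level)
  open import Relation.Binary.PropositionalEquality
  open import Relation.Nullary.Decidable using (Dec; yes; no; ¬?; _×-dec_; _→-dec_; map′; decidable-stable)
  open import Relation.Nullary.Negation using (¬_; contradiction)
  open import Relation.Unary using (Pred; Decidable; U)

  private variable
    ℓ₁ ℓ₂ p q r : Level
    X : Set ℓ₁
    Y : Set ℓ₂
    m n : ℕ

  -- Incidence of sets, neighbourhood counts and submodularity.

  ⟦_⟧ : Bool → ℕ
  ⟦ b ⟧ = if b then 1 else 0

  ⟦⟧≤1 : ∀ b → ⟦ b ⟧ ≤ 1
  ⟦⟧≤1 true  = ≤-refl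
  ⟦⟧≤1 false = z≤n

  meets : Subset n → Subset n → Bool
  meets []      []      = false
  meets (a ∷ I) (b ∷ S) = a ∧ b ∨ meets I S

  meets⁻ : (I S : Subset n) → meets I S ≡ true → ∃[ i ] i ∈ I × i ∈ S
  meets⁻ []          []          ()
  meets⁻ (true  ∷ I) (true  ∷ S) _ = zero , here , here
  meets⁻ (true  ∷ I) (false ∷ S) p with i , q , r ← meets⁻ I S p = suc i , there q , there r
  meets⁻ (false ∷ I) (b     ∷ S) p with i , q , r ← meets⁻ I S p = suc i , there q , there r

  meets⁺ : ∀ {i} (I S : Subset n) → i ∈ I → i ∈ S → meets I S ≡ true
  meets⁺ (_ ∷ I) (_ ∷ S) here here = refl
  meets⁺ (a ∷ I) (b ∷ S) (there p) (there q) with a ∧ b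
  ... | true  = refl
  ... | false = meets⁺ I S p q

  meets-∪ : (I S R : Subset n) → meets I (S ∪ R) ≡ meets I S ∨ meets I R
  meets-∪ [] [] [] = refl
  meets-∪ (false ∷ I) (b ∷ S) (c ∷ R) = meets-∪ I S R
  meets-∪ (true ∷ I) (true ∷ S) (c ∷ R) = refl
  meets-∪ (true ∷ I) (false ∷ S) (false ∷ R) = meets-∪ I S R
  meets-∪ (true ∷ I) (false ∷ S) (true ∷ R) with meets I S
  ... | true = refl
  ... | false = refl

  meets-⊥ˡ : (S : Subset n) → meets ⊥ S ≡ false
  meets-⊥ˡ []      = refl
  meets-⊥ˡ (b ∷ S) = meets-⊥ˡ S

  meets-mono : (I : Subset n) {S R : Subset n} → S ⊆ R → meets I S ≡ true → meets I R ≡ true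
  meets-mono I {S} {R} S⊆R p with i , q , r ← meets⁻ I S p = meets⁺ I R q (S⊆R r)

  ⟦meets⟧-mono : (I : Subset n) {S R : Subset n} → S ⊆ R → ⟦ meets I S ⟧ ≤ ⟦ meets I R ⟧
  ⟦meets⟧-mono I {S} {R} S⊆R with meets I S in eq
  ... | false = z≤n
  ... | true  rewrite meets-mono I S⊆R eq = ≤-refl

  -- Meeting the union means meeting `S` or `R`, and meeting the intersection implies meeting both.
  ⟦meets⟧-submodular : (I S R : Subset n) →
    ⟦ meets I (S ∪ R) ⟧ + ⟦ meets I (S ∩ R) ⟧ ≤ ⟦ meets I S ⟧ + ⟦ meets I R ⟧
  ⟦meets⟧-submodular I S R rewrite meets-∪ I S R
    with meets I S | ⟦meets⟧-mono I (p∩q⊆p S R) | meets I R | ⟦meets⟧-mono I (p∩q⊆q S R)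
  ... | true  | p | true  | q = +-monoʳ-≤ 1 q
  ... | true  | p | false | q = +-monoʳ-≤ 1 q
  ... | false | p | true  | q = +-monoʳ-≤ 1 p
  ... | false | p | false | q = p

  Family : ℕ → ℕ → Set
  Family m n = Vec (Subset n) m

  -- The right-hand side of Hall's condition: the number of left vertices in `T` with a neighbour in
  -- `S`. Keeping `T` as an argument lets one function serve both counts.
  cover : Family m n → Subset m → Subset n → ℕ
  cover []      []          S = 0
  cover (I ∷ H) (true  ∷ T) S = ⟦ meets I S ⟧ + cover H T S
  cover (I ∷ H) (false ∷ T) S = cover H T S

  weight : Vec ℕ n → Subset n → ℕ
  weight []      []          = 0
  weight (a ∷ d) (true  ∷ S) = a + weight d S
  weight (a ∷ d) (false ∷ S) = weight d S

  record Polymatroid (ρ : Subset n → ℕ) : Set where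
    field
      mono       : ∀ {S R} → S ⊆ R → ρ S ≤ ρ R
      submodular : ∀ S R → ρ (S ∪ R) + ρ (S ∩ R) ≤ ρ S + ρ R

  open Polymatroid

  +-interchange-≤ : ∀ {a b c d a′ b′ c′ d′} → a + b ≤ c + d → a′ + b′ ≤ c′ + d′ →
    (a + a′) + (b + b′) ≤ (c + c′) + (d + d′)
  +-interchange-≤ {a} {b} {c} {d} {a′} {b′} {c′} {d′} p q = begin
    (a + a′) + (b + b′) ≡⟨ interchange a a′ b b′ ⟩
    (a + b) + (a′ + b′) ≤⟨ +-mono-≤ p q ⟩
    (c + d) + (c′ + d′) ≡⟨ interchange c d c′ d′ ⟩
    (c + c′) + (d + d′) ∎
    where
    open ≤-Reasoning

  cover-polymatroid : (H : Family m n) (T : Subset m) → Polymatroid (cover H T)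
  cover-polymatroid [] [] = record { mono = λ _ → z≤n ; submodular = λ _ _ → z≤n }
  cover-polymatroid (I ∷ H) (false ∷ T) = cover-polymatroid H T
  cover-polymatroid (I ∷ H) (true ∷ T) = record
    { mono       = λ S⊆R → +-mono-≤ (⟦meets⟧-mono I S⊆R) (P .mono S⊆R)
    ; submodular = λ S R → +-interchange-≤ {a = ⟦ meets I (S ∪ R) ⟧} {c = ⟦ meets I S ⟧}
                             (⟦meets⟧-submodular I S R) (P .submodular S R)
    }
    where P = cover-polymatroid H T

  cover≤∥∥ : (H : Family m n) (T : Subset m) (S : Subset n) → cover H T S ≤ ∥ T ∥
  cover≤∥∥ [] [] S = z≤n
  cover≤∥∥ (I ∷ H) (false ∷ T) S = cover≤∥∥ H T S
  cover≤∥∥ (I ∷ H) (true ∷ T) S = +-mono-≤ (⟦⟧≤1 (meets I S)) (cover≤∥∥ H T S)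

  weight-modular : (d : Vec ℕ n) (S R : Subset n) →
    weight d (S ∪ R) + weight d (S ∩ R) ≡ weight d S + weight d R
  weight-modular [] [] [] = refl
  weight-modular (a ∷ d) (true ∷ S) (true ∷ R) = begin
    (a + u) + (a + v) ≡⟨ interchange a u a v ⟩
    (a + a) + (u + v) ≡⟨ cong ((a + a) +_) (weight-modular d S R) ⟩
    (a + a) + (x + y) ≡⟨ interchange a x a y ⟨
    (a + x) + (a + y) ∎
    where
    open ≡-Reasoning
    u = weight d (S ∪ R)
    v = weight d (S ∩ R)
    x = weight d S
    y = weight d R
  weight-modular (a ∷ d) (true ∷ S) (false ∷ R)
    rewrite +-assoc a (weight d (S ∪ R)) (weight d (S ∩ R)) | weight-modular d S R
    = sym (+-assoc a (weight d S) (weight d R))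
  weight-modular (a ∷ d) (false ∷ S) (true ∷ R)
    rewrite +-assoc a (weight d (S ∪ R)) (weight d (S ∩ R)) | weight-modular d S R
    = x∙yz≈y∙xz a (weight d S) (weight d R)
  weight-modular (a ∷ d) (false ∷ S) (false ∷ R) = weight-modular d S R

  weight-split : (d : Vec ℕ n) (S R : Subset n) →
    weight d (S ∩ R) + weight d (S ∩ ∁ R) ≡ weight d S
  weight-split [] [] [] = refl
  weight-split (a ∷ d) (false ∷ S) (_ ∷ R) = weight-split d S R
  weight-split (a ∷ d) (true ∷ S) (true ∷ R) =
    trans (+-assoc a _ _) (cong (a +_) (weight-split d S R))
  weight-split (a ∷ d) (true ∷ S) (false ∷ R) =
    trans (x∙yz≈y∙xz (weight d (S ∩ R)) a (weight d (S ∩ ∁ R))) (cong (a +_) (weight-split d S R))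

  weight-⊥ : (d : Vec ℕ n) → weight d ⊥ ≡ 0
  weight-⊥ []      = refl
  weight-⊥ (_ ∷ d) = weight-⊥ d

  weight-⁅⁆ : (d : Vec ℕ n) (i : Fin n) → weight d ⁅ i ⁆ ≡ lookup d i
  weight-⁅⁆ (a ∷ d) zero    = trans (cong (a +_) (weight-⊥ d)) (+-identityʳ a)
  weight-⁅⁆ (_ ∷ d) (suc i) = weight-⁅⁆ d i

  weight-insert : (d : Vec ℕ n) {S : Subset n} {i : Fin n} → i ∈ S →
    weight d S ≡ lookup d i + weight d (S ∩ ∁ ⁅ i ⁆)
  weight-insert d {S} {i} i∈S = begin
    weight d S ≡⟨ weight-split d S ⁅ i ⁆ ⟨
    weight d (S ∩ ⁅ i ⁆) + weight d (S ∩ ∁ ⁅ i ⁆) ≡⟨ cong (λ A → weight d A + weight d (S ∩ ∁ ⁅ i ⁆)) eq ⟩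
    weight d ⁅ i ⁆ + weight d (S ∩ ∁ ⁅ i ⁆) ≡⟨ cong (_+ weight d (S ∩ ∁ ⁅ i ⁆)) (weight-⁅⁆ d i) ⟩
    lookup d i + weight d (S ∩ ∁ ⁅ i ⁆) ∎
    where
    open ≡-Reasoning
    eq : S ∩ ⁅ i ⁆ ≡ ⁅ i ⁆
    eq = ⊆-antisym (p∩q⊆q S ⁅ i ⁆)
      λ x∈ → x∈p∩q⁺ (subst (_∈ S) (sym (x∈⁅y⁆⇒x≡y i x∈)) i∈S , x∈)

  infixl 7 _↾_
  -- Entries outside `R` become zero instead of being removed, so that both parts of a split vector
  -- are still tested against subsets of the same ground set.
  _↾_ : Vec ℕ n → Subset n → Vec ℕ n
  d ↾ R = zipWith (λ a b → if b then a else 0) d R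

  weight-↾ : (d : Vec ℕ n) (R S : Subset n) → weight (d ↾ R) S ≡ weight d (S ∩ R)
  weight-↾ [] [] [] = refl
  weight-↾ (a ∷ d) (_ ∷ R) (false ∷ S) = weight-↾ d R S
  weight-↾ (a ∷ d) (true ∷ R) (true ∷ S) = cong (a +_) (weight-↾ d R S)
  weight-↾ (a ∷ d) (false ∷ R) (true ∷ S) = weight-↾ d R S

  -- Hall's condition and least sets of excess one.

  Hall : (Subset n → ℕ) → Pred (Vec ℕ n) _
  Hall ρ d = ∀ S → weight d S ≤ ρ S

  -- One further neighbourhood raises `ρ` by at most one on each set. These are therefore the
  -- vectors that fail Hall's condition by so little that one neighbourhood can repair it, and `R`
  -- is the set that this neighbourhood has to meet.
  record MinTight (ρ : Subset n → ℕ) (d : Vec ℕ n) (R : Subset n) : Set where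
    constructor minTight
    field
      bound   : ∀ S → weight d S ≤ suc (ρ S)
      tight   : weight d R ≡ suc (ρ R)
      minimal : ∀ {S} → weight d S ≡ suc (ρ S) → R ⊆ S

  open MinTight

  allSubsets? : ∀ {p} {P : Pred (Subset n) p} → Decidable P → Dec (∀ S → P S)
  allSubsets? P? = map′ (λ ¬∃ S → decidable-stable (P? S) (λ ¬p → ¬∃ (S , ¬p)))
                        (λ all (S , ¬p) → ¬p (all S))
                        (¬? (anySubset? (λ S → ¬? (P? S))))

  Hall? : (ρ : Subset n → ℕ) → Decidable (Hall ρ)
  Hall? ρ d = allSubsets? λ S → weight d S ≤? ρ S

  MinTight? : (ρ : Subset n → ℕ) (d : Vec ℕ n) → Decidable (MinTight ρ d)
  MinTight? ρ d R = map′ (λ (b , t , m) → minTight b t (λ {S} → m S))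
                         (λ (minTight b t m) → b , t , λ S → m {S})
    (allSubsets? (λ S → weight d S ≤? suc (ρ S))
     ×-dec (weight d R ≟ suc (ρ R))
     ×-dec allSubsets? (λ S → (weight d S ≟ suc (ρ S)) →-dec (R ⊆? S)))

  minTight-unique : ∀ {ρ : Subset n → ℕ} {d R R′} → MinTight ρ d R → MinTight ρ d R′ → R ≡ R′
  minTight-unique p q = ⊆-antisym (p .minimal (q .tight)) (q .minimal (p .tight))

  minTight⇒¬Hall : ∀ {ρ : Subset n → ℕ} {d R} → MinTight ρ d R → ¬ Hall ρ d
  minTight⇒¬Hall {R = R} p h = 1+n≰n (≤-trans (≤-reflexive (sym (p .tight))) (h R))

  module _ {ρ : Subset n → ℕ} (P : Polymatroid ρ) where

    private
      Tight : Vec ℕ n → Pred (Subset n) _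
      Tight d S = weight d S ≡ suc (ρ S)

    -- Weight is modular and `ρ` submodular, so the excess is supermodular. Two sets attaining its
    -- upper bound force their union and intersection to attain it too.
    tight-∩ : ∀ {d S R} → (∀ S → weight d S ≤ suc (ρ S)) → Tight d S → Tight d R → Tight d (S ∩ R)
    tight-∩ {d} {S} {R} b s r = ≤-antisym (b (S ∩ R)) (+-cancelˡ-≤ (weight d (S ∪ R)) _ _ (begin
      weight d (S ∪ R) + suc (ρ (S ∩ R)) ≤⟨ +-monoˡ-≤ _ (b (S ∪ R)) ⟩
      suc (ρ (S ∪ R)) + suc (ρ (S ∩ R)) ≡⟨ cong suc (+-suc _ _) ⟩
      suc (suc (ρ (S ∪ R) + ρ (S ∩ R))) ≤⟨ s≤s (s≤s (P .submodular S R)) ⟩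
      suc (suc (ρ S + ρ R)) ≡⟨ cong suc (+-suc _ _) ⟨
      suc (ρ S) + suc (ρ R) ≡⟨ cong₂ _+_ s r ⟨
      weight d S + weight d R ≡⟨ weight-modular d S R ⟨
      weight d (S ∪ R) + weight d (S ∩ R) ∎))
      where open ≤-Reasoning

    -- Shrink a tight set by intersecting it with tight sets not containing it.
    minTight-exists : ∀ {d S} → (∀ S → weight d S ≤ suc (ρ S)) → Tight d S → ∃[ R ] MinTight ρ d R
    minTight-exists {d} {S₀} b t₀ = go (suc ∥ S₀ ∥) S₀ t₀ ≤-refl
      where
      go : ∀ k S → Tight d S → ∥ S ∥ < k → ∃[ R ] MinTight ρ d R
      go (suc k) S t S<k with anySubset? (λ R → (weight d R ≟ suc (ρ R)) ×-dec ¬? (S ⊆? R))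
      ... | no ¬∃ = S , minTight b t (λ {R} r → decidable-stable (S ⊆? R) λ ¬⊆ → ¬∃ (R , r , ¬⊆))
      ... | yes (R , r , S⊈R) with nonempty? (S ∩ ∁ R)
      ... | yes (i , i∈) with i∈S , i∈∁R ← x∈p∩q⁻ S (∁ R) i∈ =
        go k (S ∩ R) (tight-∩ {d} b t r)
          (<-≤-trans (p⊂q⇒∣p∣<∣q∣ (p∩q⊆p S R , i , i∈S , λ j → x∈∁p⇒x∉p i∈∁R (p∩q⊆q S R j)))
                     (s≤s⁻¹ S<k))
      ... | no ¬ne = contradiction (λ {i} i∈S → x∉∁p⇒x∈p λ i∈∁R → ¬ne (i , x∈p∩q⁺ (i∈S , i∈∁R))) S⊈R

    -- Were the entry zero, removing `i` from `R` would keep the weight and not increase `ρ`, giving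
    -- a tight set that does not contain `R`.
    minTight⇒nonzero : ∀ {d R i} → MinTight ρ d R → i ∈ R → 0 < lookup d i
    minTight⇒nonzero {d} {R} {i} p i∈R = n≢0⇒n>0 λ dᵢ≡0 →
      let tightR : Tight d (R ∩ ∁ ⁅ i ⁆)
          tightR = ≤-antisym (p .bound _) (≤-trans (s≤s (P .mono (p∩q⊆p R (∁ ⁅ i ⁆))))
            (≤-reflexive (trans (sym (p .tight))
              (trans (weight-insert d i∈R) (cong (_+ weight d (R ∩ ∁ ⁅ i ⁆)) dᵢ≡0)))))
      in x∈p⇒x∉∁p (x∈⁅x⁆ i) (p∩q⊆q R _ (p .minimal tightR i∈R))

    weight≤ : ∀ {d S} I → Hall (λ S → ⟦ meets I S ⟧ + ρ S) d → weight d S ≤ suc (ρ S)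
    weight≤ {S = S} I h = ≤-trans (h S) (+-monoˡ-≤ (ρ S) (⟦⟧≤1 (meets I S)))

    -- Without `I` the excess is at most one. If it is one somewhere, the least set attaining it
    -- satisfies the condition only thanks to `I`, so `I` meets it.
    hall-insert⁻ : ∀ {d} I → Hall (λ S → ⟦ meets I S ⟧ + ρ S) d →
      Hall ρ d ⊎ ∃[ R ] meets I R ≡ true × MinTight ρ d R
    hall-insert⁻ {d} I h with anySubset? (λ S → weight d S ≟ suc (ρ S))
    ... | no ¬∃ = inj₁ λ S → s≤s⁻¹ (≤∧≢⇒< (weight≤ {d} I h) (λ eq → ¬∃ (S , eq)))
    ... | yes (S , t) with R , p ← minTight-exists (λ _ → weight≤ {d} I h) t = inj₂ (R , meetsR , p)
      where
      meetsR : meets I R ≡ true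
      meetsR with meets I R | h R
      ... | true | _ = refl
      ... | false | q = contradiction (≤-trans (≤-reflexive (sym (p .tight))) q) 1+n≰n

    hall-insert⁺ˡ : ∀ {d} I → Hall ρ d → Hall (λ S → ⟦ meets I S ⟧ + ρ S) d
    hall-insert⁺ˡ I h S = ≤-trans (h S) (m≤n+m _ _)

    -- Every tight set contains `R`, hence meets `I` and gains the missing unit.
    hall-insert⁺ʳ : ∀ {d R} I → meets I R ≡ true → MinTight ρ d R →
      Hall (λ S → ⟦ meets I S ⟧ + ρ S) d
    hall-insert⁺ʳ {d} I mR p S with m≤n⇒m<n∨m≡n (p .bound S)
    ... | inj₁ lt = ≤-trans (s≤s⁻¹ lt) (m≤n+m _ _)
    ... | inj₂ eq rewrite meets-mono I (p .minimal eq) mR = ≤-reflexive eq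

    -- σ is the contraction ρ / R.
    module _ {σ : Subset n → ℕ} {R : Subset n} (contract : ∀ S → σ S + ρ R ≡ ρ (S ∪ R)) where

      private
        ∩∪-absorb : ∀ (A B : Subset n) → (A ∪ B) ∩ B ≡ B
        ∩∪-absorb A B = ⊆-antisym (p∩q⊆q (A ∪ B) B) λ x → x∈p∩q⁺ (q⊆p∪q A B x , x)

        ∪∩∁ : ∀ {k} (A B : Subset k) → (A ∪ B) ∩ ∁ B ≡ A ∩ ∁ B
        ∪∩∁ [] [] = refl
        ∪∩∁ (a ∷ A) (true ∷ B) rewrite ∪∩∁ A B with a
        ... | true = refl
        ... | false = refl
        ∪∩∁ (a ∷ A) (false ∷ B) rewrite ∪∩∁ A B with a
        ... | true = refl
        ... | false = refl

      -- Inside `R`, monotonicity carries everything from `S ∩ R` to `S`. Outside, subtract the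
      -- equality at `R` from the bound at `S ∪ R`: both contain the extra one, which cancels.
      minTight-split⁻ : ∀ {d} → MinTight ρ d R → MinTight ρ (d ↾ R) R × Hall σ (d ↾ ∁ R)
      minTight-split⁻ {d} p =
        minTight bnd (trans (weight-↾ d R R) (trans (cong (weight d) (∩-idem R)) (p .tight))) mini , hall
        where
        open ≤-Reasoning
        bnd : ∀ S → weight (d ↾ R) S ≤ suc (ρ S)
        bnd S = begin
          weight (d ↾ R) S ≡⟨ weight-↾ d R S ⟩
          weight d (S ∩ R) ≤⟨ p .bound (S ∩ R) ⟩
          suc (ρ (S ∩ R))  ≤⟨ s≤s (P .mono (p∩q⊆p S R)) ⟩
          suc (ρ S) ∎
        mini : ∀ {S} → weight (d ↾ R) S ≡ suc (ρ S) → R ⊆ S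
        mini {S} eq = p∩q⊆p S R ∘ p .minimal (≤-antisym (p .bound _) (begin
          suc (ρ (S ∩ R))  ≤⟨ s≤s (P .mono (p∩q⊆p S R)) ⟩
          suc (ρ S)        ≡⟨ eq ⟨
          weight (d ↾ R) S ≡⟨ weight-↾ d R S ⟩
          weight d (S ∩ R) ∎))
        hall : Hall σ (d ↾ ∁ R)
        hall S = +-cancelʳ-≤ (weight d R) _ _ (begin
          weight (d ↾ ∁ R) S + weight d R ≡⟨ +-comm _ (weight d R) ⟩
          weight d R + weight (d ↾ ∁ R) S ≡⟨ cong (weight d R +_) (weight-↾ d (∁ R) S) ⟩
          weight d R + weight d (S ∩ ∁ R) ≡⟨ cong₂ (λ A B → weight d A + weight d B) (∩∪-absorb S R) (∪∩∁ S R) ⟨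
          weight d ((S ∪ R) ∩ R) + weight d ((S ∪ R) ∩ ∁ R) ≡⟨ weight-split d (S ∪ R) R ⟩
          weight d (S ∪ R) ≤⟨ p .bound (S ∪ R) ⟩
          suc (ρ (S ∪ R)) ≡⟨ cong suc (contract S) ⟨
          suc (σ S + ρ R) ≡⟨ +-suc (σ S) (ρ R) ⟨
          σ S + suc (ρ R) ≡⟨ cong (σ S +_) (p .tight) ⟨
          σ S + weight d R ∎)

      -- The bounds for the two parts add up to at most `suc (ρ S)` by submodularity, which is
      -- `aux`. If `S` is tight, the whole chain is an equality, so `S ∩ R` is tight for the inner
      -- part and therefore contains `R`.
      minTight-split⁺ : ∀ {d} → MinTight ρ (d ↾ R) R → Hall σ (d ↾ ∁ R) → MinTight ρ d R
      minTight-split⁺ {d} p h = minTight bnd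
        (trans (trans (cong (weight d) (sym (∩-idem R))) (sym (weight-↾ d R R))) (p .tight)) mini
        where
        open ≤-Reasoning
        aux : ∀ S → ρ (S ∩ R) + σ S ≤ ρ S
        aux S = +-cancelʳ-≤ (ρ R) _ _ (begin
          ρ (S ∩ R) + σ S + ρ R ≡⟨ +-assoc (ρ (S ∩ R)) _ _ ⟩
          ρ (S ∩ R) + (σ S + ρ R) ≡⟨ cong (ρ (S ∩ R) +_) (contract S) ⟩
          ρ (S ∩ R) + ρ (S ∪ R) ≡⟨ +-comm (ρ (S ∩ R)) _ ⟩
          ρ (S ∪ R) + ρ (S ∩ R) ≤⟨ P .submodular S R ⟩
          ρ S + ρ R ∎)
        wb : ∀ S → weight d S ≤ weight d (S ∩ R) + σ S
        wb S = begin
          weight d S ≡⟨ weight-split d S R ⟨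
          weight d (S ∩ R) + weight d (S ∩ ∁ R) ≡⟨ cong (weight d (S ∩ R) +_) (weight-↾ d (∁ R) S) ⟨
          weight d (S ∩ R) + weight (d ↾ ∁ R) S ≤⟨ +-monoʳ-≤ _ (h S) ⟩
          weight d (S ∩ R) + σ S ∎
        eq∩ : ∀ S → weight (d ↾ R) (S ∩ R) ≡ weight d (S ∩ R)
        eq∩ S = trans (weight-↾ d R (S ∩ R)) (cong (weight d) (trans (∩-assoc S R R) (cong (S ∩_) (∩-idem R))))
        wb∩ : ∀ S → weight d (S ∩ R) ≤ suc (ρ (S ∩ R))
        wb∩ S = subst (_≤ suc (ρ (S ∩ R))) (eq∩ S) (p .bound (S ∩ R))
        bnd : ∀ S → weight d S ≤ suc (ρ S)
        bnd S = begin
          weight d S ≤⟨ wb S ⟩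
          weight d (S ∩ R) + σ S ≤⟨ +-monoˡ-≤ (σ S) (wb∩ S) ⟩
          suc (ρ (S ∩ R) + σ S) ≤⟨ s≤s (aux S) ⟩
          suc (ρ S) ∎
        mini : ∀ {S} → weight d S ≡ suc (ρ S) → R ⊆ S
        mini {S} eq = p∩q⊆p S R ∘ p .minimal (trans (eq∩ S) (≤-antisym (wb∩ S)
          (+-cancelʳ-≤ (σ S) _ _ (begin
            suc (ρ (S ∩ R) + σ S) ≤⟨ s≤s (aux S) ⟩
            suc (ρ S) ≡⟨ eq ⟨
            weight d S ≤⟨ wb S ⟩
            weight d (S ∩ R) + σ S ∎))))

  -- Counting with enumerations.

  pigeonhole : {R : X → Y → Set r} {xs : List X} {ys : List Y} → Unique xs →
    (∀ {x} → x ∈ˡ xs → ∃[ y ] y ∈ˡ ys × R x y) →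
    (∀ {x x′ y} → x ∈ˡ xs → x′ ∈ˡ xs → R x y → R x′ y → x ≡ x′) →
    length xs ≤ length ys
  pigeonhole {xs = []} _ _ _ = z≤n
  pigeonhole {R = R} {xs = x ∷ xs} (x∉ ∷ u) f inj with f (here refl)
  ... | y , y∈ , xRy with ∈-∃++ y∈
  ... | ys , zs , refl = begin
    suc (length xs)             ≤⟨ s≤s (pigeonhole {R = R} u f′ (λ x∈ x′∈ → inj (there x∈) (there x′∈))) ⟩
    suc (length (ys ++ zs))     ≡⟨ cong suc (length-++ ys) ⟩
    suc (length ys + length zs) ≡⟨ +-suc (length ys) _ ⟨
    length ys + suc (length zs) ≡⟨ length-++ ys ⟨
    length (ys ++ y ∷ zs)       ∎
    where
    open ≤-Reasoning
    f′ : ∀ {x′} → x′ ∈ˡ xs → ∃[ y′ ] y′ ∈ˡ ys ++ zs × R x′ y′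
    f′ x′∈ with f (there x′∈)
    ... | y′ , y′∈ , x′Ry′ with ∈-++⁻ ys y′∈
    ... | inj₁ y′∈ys = y′ , ∈-++⁺ˡ y′∈ys , x′Ry′
    ... | inj₂ (there y′∈zs) = y′ , ∈-++⁺ʳ ys y′∈zs , x′Ry′
    ... | inj₂ (here refl) = contradiction (inj (here refl) (there x′∈) xRy x′Ry′) (All.lookup x∉ x′∈)

  -- Both inequalities come from `pigeonhole`. One follows `π`; the other follows preimages under
  -- `π`, for which only existence is given. Hence the relation in place of a map there.
  ∣∣-bijection : {P : Pred X p} {Q : Pred Y q} (E : Enumeration P) (F : Enumeration Q) (π : Y → X) →
    (∀ {y} → Q y → P (π y)) →
    (∀ {y y′} → Q y → Q y′ → π y ≡ π y′ → y ≡ y′) →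
    (∀ {x} → P x → ∃[ y ] Q y × x ≡ π y) →
    ∣ E ∣ ≡ ∣ F ∣
  ∣∣-bijection E F π sd inj surj = ≤-antisym
    (pigeonhole {R = λ x y → x ≡ π y} (E .unique)
      (λ x∈ → case surj (All.lookup (E .sound) x∈) of λ (y , qy , eq) → y , F .complete qy , eq)
      (λ _ _ x≡ x′≡ → trans x≡ (sym x′≡)))
    (pigeonhole {R = λ y x → π y ≡ x} (F .unique)
      (λ {y} y∈ → π y , E .complete (sd (All.lookup (F .sound) y∈)) , refl)
      (λ y∈ y′∈ e e′ → inj (All.lookup (F .sound) y∈) (All.lookup (F .sound) y′∈) (trans e (sym e′))))

  ∣∣-cong : {P : Pred X p} {Q : Pred X q} (E : Enumeration P) (F : Enumeration Q) →
    (∀ {x} → P x → Q x) → (∀ {x} → Q x → P x) → ∣ E ∣ ≡ ∣ F ∣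
  ∣∣-cong E F P⇒Q Q⇒P = ∣∣-bijection E F id Q⇒P (λ _ _ → id) (λ px → _ , P⇒Q px , refl)

  ∣∣≡0 : {P : Pred X p} (E : Enumeration P) → (∀ {x} → ¬ P x) → ∣ E ∣ ≡ 0
  ∣∣≡0 E ¬P with E .elements | E .sound
  ... | []     | _      = refl
  ... | x ∷ xs | px ∷ _ = contradiction px ¬P

  respᴱ : {P : Pred X p} {Q : Pred X q} → (∀ {x} → P x → Q x) → (∀ {x} → Q x → P x) →
    Enumeration P → Enumeration Q
  respᴱ P⇒Q Q⇒P E = record
    { elements = E .elements
    ; unique   = E .unique
    ; sound    = All.map P⇒Q (E .sound)
    ; complete = E .complete ∘ Q⇒P
    }

  filterᴱ : {P : Pred X p} {Q : Pred X q} → Decidable Q → Enumeration P → Enumeration (λ x → P x × Q x)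
  filterᴱ Q? E = record
    { elements = filter Q? (E .elements)
    ; unique   = Unique.filter⁺ Q? (E .unique)
    ; sound    = All.tabulate λ x∈ → case ∈-filter⁻ Q? {xs = E .elements} x∈ of λ
                   (x∈E , qx) → All.lookup (E .sound) x∈E , qx
    ; complete = λ (px , qx) → ∈-filter⁺ Q? (E .complete px) qx
    }

  select : {P : Pred X p} {Q : Pred X q} → Enumeration P → Decidable Q → (∀ {x} → Q x → P x) → Enumeration Q
  select E Q? Q⇒P = respᴱ proj₂ (λ qx → Q⇒P qx , qx) (filterᴱ Q? E)

  _⊎ᴱ_ : {P : Pred X p} {Q : Pred Y p} → Enumeration P → Enumeration Q → Enumeration [ P , Q ]′
  _⊎ᴱ_ E F = record
    { elements = List.map inj₁ (E .elements) ++ List.map inj₂ (F .elements)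
    ; unique   = Unique.++⁺ (Unique.map⁺ inj₁-injective (E .unique)) (Unique.map⁺ inj₂-injective (F .unique)) disj
    ; sound    = All.tabulate sound′
    ; complete = λ {z} → member z
    }
    where
    member : ∀ z → _ → z ∈ˡ List.map inj₁ (E .elements) ++ List.map inj₂ (F .elements)
    member (inj₁ x) px = ∈-++⁺ˡ (∈-map⁺ inj₁ (E .complete px))
    member (inj₂ y) qy = ∈-++⁺ʳ _ (∈-map⁺ inj₂ (F .complete qy))
    disj : ∀ {z} → ¬ (z ∈ˡ List.map inj₁ (E .elements) × z ∈ˡ List.map inj₂ (F .elements))
    disj (z∈ , z∈′) with ∈-map⁻ inj₁ z∈ | ∈-map⁻ inj₂ z∈′
    ... | _ , _ , refl | _ , _ , ()
    sound′ : ∀ {z} → z ∈ˡ List.map inj₁ (E .elements) ++ List.map inj₂ (F .elements) → _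
    sound′ z∈ with ∈-++⁻ (List.map inj₁ (E .elements)) z∈
    ... | inj₁ z∈ˡ with ∈-map⁻ inj₁ z∈ˡ
    ...   | _ , x∈ , refl = All.lookup (E .sound) x∈
    sound′ z∈ | inj₂ z∈ʳ with ∈-map⁻ inj₂ z∈ʳ
    ...   | _ , y∈ , refl = All.lookup (F .sound) y∈

  ∣⊎ᴱ∣ : {P : Pred X p} {Q : Pred Y p} (E : Enumeration P) (F : Enumeration Q) →
    ∣ E ⊎ᴱ F ∣ ≡ ∣ E ∣ + ∣ F ∣
  ∣⊎ᴱ∣ E F = trans (length-++ (List.map inj₁ (E .elements)))
    (cong₂ _+_ (length-map inj₁ (E .elements)) (length-map inj₂ (F .elements)))

  module _ {P : Pred X p} {Q : X → Pred Y q} (F : ∀ x → Enumeration (Q x)) where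

    private
      pairs : List X → List (X × Y)
      pairs []       = []
      pairs (x ∷ xs) = List.map (x ,_) (F x .elements) ++ pairs xs

      ∈-pairs⁺ : ∀ {x y xs} → x ∈ˡ xs → Q x y → (x , y) ∈ˡ pairs xs
      ∈-pairs⁺ (here refl) qy = ∈-++⁺ˡ (∈-map⁺ _ (F _ .complete qy))
      ∈-pairs⁺ {xs = x ∷ _} (there x∈) qy = ∈-++⁺ʳ (List.map (x ,_) (F x .elements)) (∈-pairs⁺ x∈ qy)

      ∈-pairs⁻ : ∀ {x y} xs → (x , y) ∈ˡ pairs xs → x ∈ˡ xs × Q x y
      ∈-pairs⁻ (x ∷ xs) xy∈ with ∈-++⁻ (List.map (x ,_) (F x .elements)) xy∈
      ... | inj₂ xy∈′ with x∈ , qy ← ∈-pairs⁻ xs xy∈′ = there x∈ , qy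
      ... | inj₁ xy∈′ with ∈-map⁻ (x ,_) xy∈′
      ...   | _ , y∈ , refl = here refl , All.lookup (F x .sound) y∈

      pairs-unique : ∀ {xs} → Unique xs → Unique (pairs xs)
      pairs-unique [] = []
      pairs-unique {x ∷ xs} (x∉ ∷ u) =
        Unique.++⁺ (Unique.map⁺ ,-injectiveʳ (F x .unique)) (pairs-unique u)
        λ (z∈ , z∈′) → case ∈-map⁻ (x ,_) z∈ of λ where
          (_ , _ , refl) → All.lookup x∉ (proj₁ (∈-pairs⁻ xs z∈′)) refl

      length-pairs : ∀ xs → length (pairs xs) ≡ sum (List.map (λ x → ∣ F x ∣) xs)
      length-pairs [] = refl
      length-pairs (x ∷ xs) = trans (length-++ (List.map (x ,_) (F x .elements)))
        (cong₂ _+_ (length-map (x ,_) (F x .elements)) (length-pairs xs))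

    Σᴱ : Enumeration P → Enumeration (λ (x , y) → P x × Q x y)
    Σᴱ E = record
      { elements = pairs (E .elements)
      ; unique   = pairs-unique (E .unique)
      ; sound    = All.tabulate λ xy∈ → case ∈-pairs⁻ (E .elements) xy∈ of λ
          (x∈ , qy) → All.lookup (E .sound) x∈ , qy
      ; complete = λ (px , qy) → ∈-pairs⁺ (E .complete px) qy
      }

    ∣Σᴱ∣ : (E : Enumeration P) → ∣ Σᴱ E ∣ ≡ sum (List.map (λ x → ∣ F x ∣) (E .elements))
    ∣Σᴱ∣ E = length-pairs (E .elements)

  sum-const : ∀ {f : X → ℕ} {c} xs → (∀ {x} → x ∈ˡ xs → f x ≡ c) → sum (List.map f xs) ≡ length xs * c
  sum-const [] eq = refl
  sum-const (x ∷ xs) eq = cong₂ _+_ (eq (here refl)) (sum-const xs (eq ∘ there))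

  sum-cong : ∀ {f g : X → ℕ} xs → (∀ {x} → x ∈ˡ xs → f x ≡ g x) → sum (List.map f xs) ≡ sum (List.map g xs)
  sum-cong [] eq = refl
  sum-cong (x ∷ xs) eq = cong₂ _+_ (eq (here refl)) (sum-cong xs (eq ∘ there))

  -- Serves to isolate the single unknown term of the deletion identity.
  sum-cancel : ∀ {f g : X → ℕ} {xs x} → Unique xs → x ∈ˡ xs →
    (∀ {y} → y ∈ˡ xs → y ≢ x → f y ≡ g y) →
    sum (List.map f xs) ≡ sum (List.map g xs) → f x ≡ g x
  sum-cancel {f = f} {g} {x ∷ xs} (x∉ ∷ _) (here refl) eq total = +-cancelʳ-≡ (sum (List.map f xs)) (f x) (g x)
    (trans total (cong (g x +_) (sym (sum-cong xs λ y∈ → eq (there y∈) (≢-sym (All.lookup x∉ y∈))))))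
  sum-cancel {f = f} {g} {y ∷ xs} (y∉ ∷ u) (there x∈) eq total = sum-cancel u x∈ (eq ∘ there)
    (+-cancelˡ-≡ (f y) _ _ (trans total (cong (_+ _) (sym (eq (here refl) (All.lookup y∉ x∈))))))

  _×ᴱ_ : {P : Pred X p} {Q : Pred Y q} → Enumeration P → Enumeration Q → Enumeration (λ (x , y) → P x × Q y)
  E ×ᴱ F = Σᴱ (λ _ → F) E

  ∣×ᴱ∣ : {P : Pred X p} {Q : Pred Y q} (E : Enumeration P) (F : Enumeration Q) → ∣ E ×ᴱ F ∣ ≡ ∣ E ∣ * ∣ F ∣
  ∣×ᴱ∣ E F = trans (∣Σᴱ∣ (λ _ → F) E) (sum-const (E .elements) λ _ → refl)

  oneᴱ : (x : X) → Enumeration (_≡ x)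
  oneᴱ x = record { elements = x ∷ [] ; unique = [] ∷ [] ; sound = refl ∷ [] ; complete = λ where refl → here refl }

  imageᴱ : {P : Pred X p} {Q : Pred Y q} (f : X → Y) → (∀ {x x′} → f x ≡ f x′ → x ≡ x′) →
    (∀ {x} → P x → Q (f x)) → (∀ {y} → Q y → ∃[ x ] P x × y ≡ f x) → Enumeration P → Enumeration Q
  imageᴱ {Q = Q} f inj P⇒Q Q⇒P E = record
    { elements = List.map f (E .elements)
    ; unique   = Unique.map⁺ inj (E .unique)
    ; sound    = All.tabulate λ y∈ → case ∈-map⁻ f y∈ of λ (x , x∈ , eq) →
                   subst Q (sym eq) (P⇒Q (All.lookup (E .sound) x∈))
    ; complete = λ qy → case Q⇒P qy of λ (x , px , eq) → subst (_∈ˡ _) (sym eq) (∈-map⁺ f (E .complete px))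
    }

  vecᴱ : {P : Pred X p} → Enumeration P → ∀ n → Enumeration (VAll.All P {n})
  vecᴱ E zero = record
    { elements = [] ∷ [] ; unique = [] ∷ [] ; sound = [] ∷ [] ; complete = λ where [] → here refl }
  vecᴱ E (suc n) = imageᴱ (λ (x , v) → x ∷ v)
    (λ eq → case ∷-injective eq of λ (e , e′) → cong₂ _,_ e e′)
    (λ (px , pv) → px ∷ pv)
    (λ where (px ∷ pv) → _ , (px , pv) , refl)
    (E ×ᴱ vecᴱ E n)

  boolᴱ : Enumeration {A = Bool} U
  boolᴱ = record
    { elements = true ∷ false ∷ []
    ; unique   = ((λ ()) ∷ []) ∷ [] ∷ []
    ; sound    = _ ∷ _ ∷ []
    ; complete = λ {b} _ → member b
    }
    where
    member : ∀ b → b ∈ˡ true ∷ false ∷ []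
    member true  = here refl
    member false = there (here refl)

  subsetᴱ : {P : Pred (Subset n) p} → Decidable P → Enumeration P
  subsetᴱ {n = n} P? = select (vecᴱ boolᴱ n) P? λ _ → VAll.universal _ _

  ≤ᴱ : ∀ k → Enumeration (_≤ k)
  ≤ᴱ k = record
    { elements = upTo (suc k)
    ; unique   = Unique.upTo⁺ (suc k)
    ; sound    = All.tabulate (s≤s⁻¹ ∘ ∈-upTo⁻)
    ; complete = ∈-upTo⁺ ∘ s≤s
    }

  boundedᴱ : {P : Pred (Vec ℕ n) p} → Decidable P → ∀ k → (∀ {d} → P d → ∀ i → lookup d i ≤ k) → Enumeration P
  boundedᴱ {n = n} P? k bnd = select (vecᴱ (≤ᴱ k) n) P? λ pd → lookup⁻ (bnd pd)

  -- The recursion and its unique solution.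

  meeting : (I : Subset n) → Enumeration (λ R → meets I R ≡ true)
  meeting I = subsetᴱ λ R → meets I R ≟ᵇ true

  infix 8 _∖∖_
  -- A neighbourhood meeting `R` is emptied rather than removed: it no longer covers anything, while
  -- left vertices keep their indices and subsets `T` of them can be compared before and after.
  _∖∖_ : Family m n → Subset n → Family m n
  H ∖∖ R = Vec.map (λ I → if meets I R then ⊥ else I) H

  -- The sums run over all `R` meeting a given set, inside `A` or not; `support` makes the terms
  -- outside vanish. Such an `R` is nonempty, so `A ∩ ∁ R` is strictly smaller than `A` whenever
  -- `R ⊆ A`. The number of neighbourhoods varies within one theory because `cons` changes it.
  record CountingTheory (n : ℕ) : Set where
    field
      N : ∀ {m} → Family m n → Subset n → ℕ
      g : ∀ {m} → Family m n → Subset n → Subset n → ℕ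
      nil-⊥    : N [] ⊥ ≡ 1
      nil      : ∀ {A} → Nonempty A → N [] A ≡ 0
      cons     : ∀ {m} I (H : Family m n) A →
                 N (I ∷ H) A ≡ N H A + sum (List.map (g H A) (meeting I .elements))
      contract : ∀ {m} (H : Family m n) {A R} → R ⊆ A → g H A R ≡ g H R R * N (H ∖∖ R) (A ∩ ∁ R)
      delete   : ∀ {m} (H : Family m n) {A i} → i ∈ A →
                 N H (A ∩ ∁ ⁅ i ⁆) ≡ sum (List.map (g H A) (meeting ⁅ i ⁆ .elements))
      support  : ∀ {m} (H : Family m n) {A R} → R ⊈ A → g H A R ≡ 0

  ∥A∩∁R∥<∥A∥ : ∀ {A R : Subset n} {i} → i ∈ A → i ∈ R → ∥ A ∩ ∁ R ∥ < ∥ A ∥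
  ∥A∩∁R∥<∥A∥ {A = A} {R} i∈A i∈R =
    p⊂q⇒∣p∣<∣q∣ (p∩q⊆p A (∁ R) , _ , i∈A , λ i∈ → x∈p⇒x∉∁p i∈R (p∩q⊆q A (∁ R) i∈))

  ⊆∧≢⇒∥∥< : ∀ {A R : Subset n} → R ⊆ A → R ≢ A → ∥ R ∥ < ∥ A ∥
  ⊆∧≢⇒∥∥< {A = A} {R} R⊆A R≢A with nonempty? (A ∩ ∁ R)
  ... | yes (i , i∈) with i∈A , i∈∁R ← x∈p∩q⁻ A (∁ R) i∈ = p⊂q⇒∣p∣<∣q∣ (R⊆A , i , i∈A , x∈∁p⇒x∉p i∈∁R)
  ... | no ¬ne = contradiction (⊆-antisym R⊆A λ {i} i∈A → x∉∁p⇒x∈p λ i∈∁R → ¬ne (i , x∈p∩q⁺ (i∈A , i∈∁R))) R≢A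

  module _ (𝒳 𝒴 : CountingTheory n) where

    private
      module X = CountingTheory 𝒳
      module Y = CountingTheory 𝒴

      -- The two claims are carried together because each feeds the other. The second asks for a
      -- nonempty `A` because its proof deletes an element of `A`.
      Agree : Subset n → Set
      Agree A = (∀ {m} (H : Family m n) → X.N H A ≡ Y.N H A)
              × (Nonempty A → ∀ {m} (H : Family m n) → X.g H A A ≡ Y.g H A A)

      module Step {A : Subset n} (IH : ∀ {B : Subset n} → ∥ B ∥ < ∥ A ∥ → Agree B) where

        -- For `R` nonempty and properly inside `A`, contraction leads to counts for `R` and
        -- `A ∩ ∁ R`, both smaller than `A`.
        g-agree-≢ : ∀ {R} → Nonempty R → R ≢ A → (H : Family m n) → X.g H A R ≡ Y.g H A R
        g-agree-≢ {R = R} (j , j∈R) R≢A H with R ⊆? A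
        ... | no R⊈A = trans (X.support H R⊈A) (sym (Y.support H R⊈A))
        ... | yes R⊆A = begin
          X.g H A R                               ≡⟨ X.contract H R⊆A ⟩
          X.g H R R * X.N (H ∖∖ R) (A ∩ ∁ R) ≡⟨ cong₂ _*_ (proj₂ (IH (⊆∧≢⇒∥∥< R⊆A R≢A)) (j , j∈R) H)
                                                           (proj₁ (IH (∥A∩∁R∥<∥A∥ (R⊆A j∈R) j∈R)) (H ∖∖ R)) ⟩
          Y.g H R R * Y.N (H ∖∖ R) (A ∩ ∁ R) ≡⟨ Y.contract H R⊆A ⟨
          Y.g H A R ∎
          where open ≡-Reasoning

        nonempty : ∀ {I R : Subset n} → R ∈ˡ meeting I .elements → Nonempty R
        nonempty {I} {R} R∈ with i , _ , i∈R ← meets⁻ I R (All.lookup (meeting I .sound) R∈) = i , i∈R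

        -- Contraction at `R = A` only returns the unknown itself as a factor. Deleting `i` instead
        -- gives a sum whose total is known by induction and in which `g H A A` is the only term not
        -- yet known.
        g-agree-≡ : Nonempty A → (H : Family m n) → X.g H A A ≡ Y.g H A A
        g-agree-≡ (i , i∈A) H = sum-cancel (meeting ⁅ i ⁆ .unique)
          (meeting ⁅ i ⁆ .complete (meets⁺ ⁅ i ⁆ A (x∈⁅x⁆ i) i∈A))
          (λ R∈ R≢A → g-agree-≢ (nonempty {⁅ i ⁆} R∈) R≢A H)
          (trans (sym (X.delete H i∈A))
            (trans (proj₁ (IH (∥A∩∁R∥<∥A∥ i∈A (x∈⁅x⁆ i))) H) (Y.delete H i∈A)))

        g-agree : ∀ {R} → Nonempty R → (H : Family m n) → X.g H A R ≡ Y.g H A R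
        g-agree {R = R} ne H with ≡-dec _≟ᵇ_ R A
        ... | yes refl = g-agree-≡ ne H
        ... | no R≢A   = g-agree-≢ ne R≢A H

        N-agree : (H : Family m n) → X.N H A ≡ Y.N H A
        N-agree [] with nonempty? A
        ... | yes ne = trans (X.nil ne) (sym (Y.nil ne))
        ... | no ¬ne rewrite Empty-unique ¬ne = trans X.nil-⊥ (sym Y.nil-⊥)
        N-agree (I ∷ H) = trans (X.cons I H A) (trans
          (cong₂ _+_ (N-agree H) (sum-cong _ λ R∈ → g-agree (nonempty {I} R∈) H))
          (sym (Y.cons I H A)))

      agree : ∀ k {A} → ∥ A ∥ < k → Agree A
      agree (suc k) {A} A<k = N-agree , λ ne H → g-agree-≡ ne H
        where open Step {A} (λ B<A → agree k (<-≤-trans B<A (s≤s⁻¹ A<k)))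

    counting-unique : (H : Family m n) (A : Subset n) → X.N H A ≡ Y.N H A
    counting-unique H A = proj₁ (agree (suc ∥ A ∥) ≤-refl) H

  -- Splitting sets, vectors and families along a set.

  ⊆⇒∩≡ʳ : ∀ {A B : Subset n} → B ⊆ A → A ∩ B ≡ B
  ⊆⇒∩≡ʳ {A = A} {B} B⊆A = ⊆-antisym (p∩q⊆q A B) λ x → x∈p∩q⁺ (B⊆A x , x)

  ⊆⇒∩≡ˡ : ∀ {A B : Subset n} → A ⊆ B → A ∩ B ≡ A
  ⊆⇒∩≡ˡ {A = A} {B} A⊆B = ⊆-antisym (p∩q⊆p A B) λ x → x∈p∩q⁺ (x , A⊆B x)

  ∥∥-split : (A R : Subset n) → ∥ A ∩ R ∥ + ∥ A ∩ ∁ R ∥ ≡ ∥ A ∥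
  ∥∥-split [] [] = refl
  ∥∥-split (false ∷ A) (_ ∷ R) = ∥∥-split A R
  ∥∥-split (true ∷ A) (true ∷ R) = cong suc (∥∥-split A R)
  ∥∥-split (true ∷ A) (false ∷ R) = trans (+-suc _ _) (cong suc (∥∥-split A R))

  ∩-absorbs : (A R : Subset n) → ∥ A ∥ ≤ ∥ A ∩ R ∥ → A ∩ R ≡ A
  ∩-absorbs [] [] _ = refl
  ∩-absorbs (false ∷ A) (_ ∷ R) p = cong (false ∷_) (∩-absorbs A R p)
  ∩-absorbs (true ∷ A) (true ∷ R) p = cong (true ∷_) (∩-absorbs A R (s≤s⁻¹ p))
  ∩-absorbs (true ∷ A) (false ∷ R) p = contradiction (≤-trans p (∣p∩q∣≤∣p∣ A R)) 1+n≰n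

  ∩∁-unique : (A B R : Subset n) → A ∩ R ≡ B ∩ R → A ∩ ∁ R ≡ B ∩ ∁ R → A ≡ B
  ∩∁-unique [] [] [] _ _ = refl
  ∩∁-unique (a ∷ A) (b ∷ B) (r ∷ R) p q with ∷-injective p | ∷-injective q
  ... | p₀ , p₁ | q₀ , q₁ = cong₂ _∷_ (bit a b r p₀ q₀) (∩∁-unique A B R p₁ q₁)
    where
    bit : ∀ a b r → a ∧ r ≡ b ∧ r → a ∧ not r ≡ b ∧ not r → a ≡ b
    bit false false _ _ _ = refl
    bit true true _ _ _ = refl
    bit true false true () _
    bit true false false _ ()
    bit false true true () _
    bit false true false _ ()

  ∪-∩ˡ : (A B R : Subset n) → A ∩ R ≡ A → B ∩ ∁ R ≡ B → (A ∪ B) ∩ R ≡ A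
  ∪-∩ˡ [] [] [] _ _ = refl
  ∪-∩ˡ (a ∷ A) (b ∷ B) (r ∷ R) p q with ∷-injective p | ∷-injective q
  ... | p₀ , p₁ | q₀ , q₁ = cong₂ _∷_ (bit a b r p₀ q₀) (∪-∩ˡ A B R p₁ q₁)
    where
    bit : ∀ a b r → a ∧ r ≡ a → b ∧ not r ≡ b → (a ∨ b) ∧ r ≡ a
    bit true b true _ _ = refl
    bit true b false () _
    bit false true true _ ()
    bit false true false _ _ = refl
    bit false false r _ _ = refl

  ∪-∩ʳ : (A B R : Subset n) → A ∩ R ≡ A → B ∩ ∁ R ≡ B → (A ∪ B) ∩ ∁ R ≡ B
  ∪-∩ʳ [] [] [] _ _ = refl
  ∪-∩ʳ (a ∷ A) (b ∷ B) (r ∷ R) p q with ∷-injective p | ∷-injective q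
  ... | p₀ , p₁ | q₀ , q₁ = cong₂ _∷_ (bit a b r p₀ q₀) (∪-∩ʳ A B R p₁ q₁)
    where
    bit : ∀ a b r → a ∧ r ≡ a → b ∧ not r ≡ b → (a ∨ b) ∧ not r ≡ b
    bit true true true _ ()
    bit true false true _ _ = refl
    bit true b false () _
    bit false true true _ ()
    bit false true false _ _ = refl
    bit false false r _ _ = refl

  isPositive : ℕ → Bool
  isPositive zero    = false
  isPositive (suc _) = true

  supp : Vec ℕ n → Subset n
  supp = Vec.map isPositive

  𝟙 : Subset n → Vec ℕ n
  𝟙 = Vec.map ⟦_⟧

  supp-↾ : (d : Vec ℕ n) (R : Subset n) → supp (d ↾ R) ≡ supp d ∩ R
  supp-↾ [] [] = refl
  supp-↾ (zero ∷ d) (true ∷ R) = cong (false ∷_) (supp-↾ d R)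
  supp-↾ (zero ∷ d) (false ∷ R) = cong (false ∷_) (supp-↾ d R)
  supp-↾ (suc _ ∷ d) (true ∷ R) = cong (true ∷_) (supp-↾ d R)
  supp-↾ (suc _ ∷ d) (false ∷ R) = cong (false ∷_) (supp-↾ d R)

  𝟙-↾ : (A R : Subset n) → 𝟙 A ↾ R ≡ 𝟙 (A ∩ R)
  𝟙-↾ [] [] = refl
  𝟙-↾ (true ∷ A) (true ∷ R) = cong (1 ∷_) (𝟙-↾ A R)
  𝟙-↾ (true ∷ A) (false ∷ R) = cong (0 ∷_) (𝟙-↾ A R)
  𝟙-↾ (false ∷ A) (true ∷ R) = cong (0 ∷_) (𝟙-↾ A R)
  𝟙-↾ (false ∷ A) (false ∷ R) = cong (0 ∷_) (𝟙-↾ A R)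

  weight-𝟙 : (A S : Subset n) → weight (𝟙 A) S ≡ ∥ A ∩ S ∥
  weight-𝟙 [] [] = refl
  weight-𝟙 (true ∷ A) (true ∷ S) = cong suc (weight-𝟙 A S)
  weight-𝟙 (true ∷ A) (false ∷ S) = weight-𝟙 A S
  weight-𝟙 (false ∷ A) (true ∷ S) = weight-𝟙 A S
  weight-𝟙 (false ∷ A) (false ∷ S) = weight-𝟙 A S

  weight-𝟙-self : (A : Subset n) → weight (𝟙 A) A ≡ ∥ A ∥
  weight-𝟙-self A = trans (weight-𝟙 A A) (cong ∥_∥ (∩-idem A))

  ∈supp : ∀ {d : Vec ℕ n} {i} → 0 < lookup d i → i ∈ supp d
  ∈supp {d = suc _ ∷ d} {zero} p = here
  ∈supp {d = _ ∷ d} {suc i} p = there (∈supp p)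

  ∉supp : ∀ {d : Vec ℕ n} {i} → i ∉ supp d → lookup d i ≡ 0
  ∉supp {d = zero ∷ d} {zero} p = refl
  ∉supp {d = suc _ ∷ d} {zero} p = contradiction here p
  ∉supp {d = _ ∷ d} {suc i} p = ∉supp {d = d} (p ∘ there)

  supp-𝟙 : (A : Subset n) → supp (𝟙 A) ≡ A
  supp-𝟙 [] = refl
  supp-𝟙 (true ∷ A) = cong (true ∷_) (supp-𝟙 A)
  supp-𝟙 (false ∷ A) = cong (false ∷_) (supp-𝟙 A)

  minTight⊆supp : ∀ {ρ : Subset n → ℕ} {d R} → Polymatroid ρ → MinTight ρ d R → R ⊆ supp d
  minTight⊆supp P p i∈R = ∈supp (minTight⇒nonzero P p i∈R)

  ↾-split-unique : (d d′ : Vec ℕ n) (R : Subset n) → d ↾ R ≡ d′ ↾ R → d ↾ ∁ R ≡ d′ ↾ ∁ R → d ≡ d′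
  ↾-split-unique [] [] [] _ _ = refl
  ↾-split-unique (a ∷ d) (b ∷ d′) (true ∷ R) p q =
    cong₂ _∷_ (proj₁ (∷-injective p)) (↾-split-unique d d′ R (proj₂ (∷-injective p)) (proj₂ (∷-injective q)))
  ↾-split-unique (a ∷ d) (b ∷ d′) (false ∷ R) p q =
    cong₂ _∷_ (proj₁ (∷-injective q)) (↾-split-unique d d′ R (proj₂ (∷-injective p)) (proj₂ (∷-injective q)))

  ↾-merge : (d d′ : Vec ℕ n) (R : Subset n) → supp d ⊆ R → supp d′ ⊆ ∁ R →
    ∃[ e ] e ↾ R ≡ d × e ↾ ∁ R ≡ d′
  ↾-merge [] [] [] _ _ = [] , refl , refl
  ↾-merge (a ∷ d) (b ∷ d′) (r ∷ R) p q with ↾-merge d d′ R (drop-∷-⊆ p) (drop-∷-⊆ q)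
  ↾-merge (a ∷ d) (zero ∷ d′) (true ∷ R) p q | e , refl , refl = a ∷ e , refl , refl
  ↾-merge (a ∷ d) (suc b ∷ d′) (true ∷ R) p q | e , _ with () ← q here
  ↾-merge (zero ∷ d) (b ∷ d′) (false ∷ R) p q | e , refl , refl = b ∷ e , refl , refl
  ↾-merge (suc a ∷ d) (b ∷ d′) (false ∷ R) p q | e , _ with () ← p here

  neighbours : Family m n → Subset n → Subset m
  neighbours H R = Vec.map (λ I → meets I R) H

  meets-∖∖ : (I R S : Subset n) →
    ⟦ meets (if meets I R then ⊥ else I) S ⟧ + ⟦ meets I R ⟧ ≡ ⟦ meets I (S ∪ R) ⟧
  meets-∖∖ I R S rewrite meets-∪ I S R with meets I R
  ... | true  rewrite meets-⊥ˡ S | ∨-zeroʳ (meets I S) = refl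
  ... | false rewrite ∨-identityʳ (meets I S) = +-identityʳ _

  -- Identifies the cover function of `H ∖∖ R` as the contraction by `R`: a left vertex adjacent to
  -- `S ∪ R` either is adjacent to `R` or survives and is adjacent to `S`.
  cover-∖∖ : (H : Family m n) (T : Subset m) (R S : Subset n) →
    cover (H ∖∖ R) T S + cover H T R ≡ cover H T (S ∪ R)
  cover-∖∖ [] [] R S = refl
  cover-∖∖ (I ∷ H) (false ∷ T) R S = cover-∖∖ H T R S
  cover-∖∖ (I ∷ H) (true ∷ T) R S =
    trans (interchange ⟦ meets (if meets I R then ⊥ else I) S ⟧ (cover (H ∖∖ R) T S) ⟦ meets I R ⟧ (cover H T R))
          (cong₂ _+_ (meets-∖∖ I R S) (cover-∖∖ H T R S))

  -- A left vertex not adjacent to `R` contributes nothing to a subset of `R`.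
  cover-neighbours : (H : Family m n) (T : Subset m) {R S : Subset n} → S ⊆ R →
    cover H (T ∩ neighbours H R) S ≡ cover H T S
  cover-neighbours [] [] _ = refl
  cover-neighbours (I ∷ H) (false ∷ T) S⊆R = cover-neighbours H T S⊆R
  cover-neighbours (I ∷ H) (true ∷ T) {R} {S} S⊆R with meets I R in eq
  ... | true = cong (⟦ meets I S ⟧ +_) (cover-neighbours H T S⊆R)
  ... | false with meets I S in eq′
  ...   | false = cover-neighbours H T S⊆R
  ...   | true with () ← trans (sym eq) (meets-mono I S⊆R eq′)

  -- The counterpart outside `R`: the left vertices adjacent to `R` have been emptied.
  cover-∖∖-neighbours : (H : Family m n) (T : Subset m) (R S : Subset n) →
    cover (H ∖∖ R) (T ∩ ∁ (neighbours H R)) S ≡ cover (H ∖∖ R) T S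
  cover-∖∖-neighbours [] [] R S = refl
  cover-∖∖-neighbours (I ∷ H) (false ∷ T) R S = cover-∖∖-neighbours H T R S
  cover-∖∖-neighbours (I ∷ H) (true ∷ T) R S with meets I R
  ... | true rewrite meets-⊥ˡ S = cover-∖∖-neighbours H T R S
  ... | false = cong (⟦ meets I S ⟧ +_) (cover-∖∖-neighbours H T R S)

  cover≡∥∩∥ : (H : Family m n) (T : Subset m) (R : Subset n) → cover H T R ≡ ∥ T ∩ neighbours H R ∥
  cover≡∥∩∥ [] [] R = refl
  cover≡∥∩∥ (I ∷ H) (false ∷ T) R = cover≡∥∩∥ H T R
  cover≡∥∩∥ (I ∷ H) (true ∷ T) R with meets I R
  ... | true  = cong suc (cover≡∥∩∥ H T R)
  ... | false = cover≡∥∩∥ H T R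

  -- If weights depend only on the part of a set inside `R`, the values of the set function below
  -- `R` decide everything, and monotonicity extends the bounds to all sets. This allows `T` to be
  -- replaced by its part adjacent to `R`, or the reverse.
  minTight-local : ∀ {ρ ρ′ : Subset n → ℕ} {d R} → Polymatroid ρ′ →
    (∀ S → weight d S ≡ weight d (S ∩ R)) → (∀ {S} → S ⊆ R → ρ S ≡ ρ′ S) →
    MinTight ρ d R → MinTight ρ′ d R
  minTight-local {ρ = ρ} {ρ′} {d} {R} P′ loc ρ≡ρ′ p = minTight
    (λ S → ≤-trans (bnd S) (s≤s (P′ .mono (p∩q⊆p S R))))
    (trans (p .tight) (cong suc (ρ≡ρ′ {R} ⊆-refl)))
    (λ {S} t → p∩q⊆p S R ∘ p .minimal (≤-antisym (p .bound (S ∩ R)) (begin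
      suc (ρ (S ∩ R))  ≡⟨ cong suc (ρ≡ρ′ (p∩q⊆q S R)) ⟩
      suc (ρ′ (S ∩ R)) ≤⟨ s≤s (P′ .mono (p∩q⊆p S R)) ⟩
      suc (ρ′ S)       ≡⟨ t ⟨
      weight d S       ≡⟨ loc S ⟩
      weight d (S ∩ R) ∎)))
    where
    open ≤-Reasoning
    bnd : ∀ S → weight d S ≤ suc (ρ′ (S ∩ R))
    bnd S = begin
      weight d S       ≡⟨ loc S ⟩
      weight d (S ∩ R) ≤⟨ p .bound (S ∩ R) ⟩
      suc (ρ (S ∩ R))  ≡⟨ cong suc (ρ≡ρ′ (p∩q⊆q S R)) ⟩
      suc (ρ′ (S ∩ R)) ∎

  lookup≤ : ∀ (d : Vec ℕ n) k → (∀ S → weight d S ≤ k) → ∀ i → lookup d i ≤ k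
  lookup≤ d k b i = subst (_≤ k) (weight-⁅⁆ d i) (b ⁅ i ⁆)

  -- All tight sets contain `R` and hence `i`, so a set from which `i` has been removed has no
  -- excess.
  hall-delete : ∀ {ρ : Subset n → ℕ} {d R i} → Polymatroid ρ → i ∈ R → MinTight ρ d R → Hall ρ (d ↾ ∁ ⁅ i ⁆)
  hall-delete {ρ = ρ} {d} {R} {i} P i∈R p S = begin
    weight (d ↾ ∁ ⁅ i ⁆) S ≡⟨ weight-↾ d (∁ ⁅ i ⁆) S ⟩
    weight d (S ∩ ∁ ⁅ i ⁆) ≤⟨ s≤s⁻¹ (≤∧≢⇒< (p .bound _) λ t → x∈p⇒x∉∁p (x∈⁅x⁆ i) (p∩q⊆q S _ (p .minimal t i∈R))) ⟩
    ρ (S ∩ ∁ ⁅ i ⁆) ≤⟨ P .mono (p∩q⊆p S _) ⟩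
    ρ S ∎
    where open ≤-Reasoning

  ∉⇒∩∁ : ∀ {S : Subset n} {i} → i ∉ S → S ∩ ∁ ⁅ i ⁆ ≡ S
  ∉⇒∩∁ {S = S} {i} i∉S = ⊆⇒∩≡ˡ λ {x} x∈S → x∉p⇒x∈∁p λ x∈ → i∉S (subst (_∈ S) (x∈⁅y⁆⇒x≡y i x∈) x∈S)

  -- A least tight set avoiding `i` would keep its weight when entry `i` is set to zero, against
  -- Hall's condition for the reduced vector.
  minTight-delete : ∀ {ρ : Subset n → ℕ} {d S i} → Polymatroid ρ → (∀ S → weight d S ≤ suc (ρ S)) →
    weight d S ≡ suc (ρ S) → Hall ρ (d ↾ ∁ ⁅ i ⁆) → ∃[ R ] i ∈ R × MinTight ρ d R
  minTight-delete {ρ = ρ} {d} {S} {i} P b t h with minTight-exists P {d} b t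
  ... | R , p with i ∈? R
  ...   | yes i∈R = R , i∈R , p
  ...   | no i∉R = contradiction (begin
    suc (ρ R)              ≡⟨ p .tight ⟨
    weight d R             ≡⟨ cong (weight d) (∉⇒∩∁ i∉R) ⟨
    weight d (R ∩ ∁ ⁅ i ⁆) ≡⟨ weight-↾ d (∁ ⁅ i ⁆) R ⟨
    weight (d ↾ ∁ ⁅ i ⁆) R ≤⟨ h R ⟩
    ρ R ∎) 1+n≰n
    where open ≤-Reasoning

  meets-⁅⁆⁻ : ∀ {i} (R : Subset n) → meets ⁅ i ⁆ R ≡ true → i ∈ R
  meets-⁅⁆⁻ {i = i} R mt with j , j∈ , j∈R ← meets⁻ ⁅ i ⁆ R mt = subst (_∈ R) (x∈⁅y⁆⇒x≡y i j∈) j∈R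

  meets-⁅⁆⁺ : ∀ {i} (R : Subset n) → i ∈ R → meets ⁅ i ⁆ R ≡ true
  meets-⁅⁆⁺ {i = i} R = meets⁺ ⁅ i ⁆ R (x∈⁅x⁆ i)

  _≟ˢ_ : (A B : Subset n) → Dec (A ≡ B)
  _≟ˢ_ = ≡-dec _≟ᵇ_

  -- First count: vectors with a prescribed support.

  DemandHall : Family m n → Subset n → Pred (Vec ℕ n) _
  DemandHall H A d = supp d ≡ A × Hall (cover H ⊤) d

  DemandTight : Family m n → Subset n → Subset n → Pred (Vec ℕ n) _
  DemandTight H A R d = supp d ≡ A × MinTight (cover H ⊤) d R

  module _ (H : Family m n) (A : Subset n) where

    private
      cover≤m : ∀ S → cover H ⊤ S ≤ m
      cover≤m S = ≤-trans (cover≤∥∥ H ⊤ S) (∣p∣≤n ⊤)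

    demandHallᴱ : Enumeration (DemandHall H A)
    demandHallᴱ = boundedᴱ (λ d → (supp d ≟ˢ A) ×-dec Hall? (cover H ⊤) d) m
      λ {d} (_ , h) → lookup≤ d m λ S → ≤-trans (h S) (cover≤m S)

    demandTightᴱ : ∀ R → Enumeration (DemandTight H A R)
    demandTightᴱ R = boundedᴱ (λ d → (supp d ≟ˢ A) ×-dec MinTight? (cover H ⊤) d R) (suc m)
      λ {d} (_ , p) → lookup≤ d (suc m) λ S → ≤-trans (p .bound S) (s≤s (cover≤m S))

  private
    zeros : (d : Vec ℕ n) → supp d ≡ ⊥ → d ≡ Vec.replicate n 0
    zeros [] _ = refl
    zeros (zero ∷ d) eq = cong (0 ∷_) (zeros d (proj₂ (∷-injective eq)))
    zeros (suc _ ∷ d) eq with () ← proj₁ (∷-injective eq)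

    supp-zeros : ∀ n → supp (Vec.replicate n 0) ≡ ⊥
    supp-zeros zero = refl
    supp-zeros (suc n) = cong (false ∷_) (supp-zeros n)

    weight-zeros : (S : Subset n) → weight (Vec.replicate n 0) S ≡ 0
    weight-zeros [] = refl
    weight-zeros (true ∷ S) = weight-zeros S
    weight-zeros (false ∷ S) = weight-zeros S

    at-zero : (d : Vec ℕ n) (i : Fin n) → lookup d i ≡ 0 → d [ i ]≔ 0 ≡ d
    at-zero (zero ∷ d) zero refl = refl
    at-zero (a ∷ d) (suc i) eq = cong (a ∷_) (at-zero d i eq)

    ↾-update : (d : Vec ℕ n) (i : Fin n) (t : ℕ) → (d [ i ]≔ t) ↾ ∁ ⁅ i ⁆ ≡ d ↾ ∁ ⁅ i ⁆
    ↾-update (a ∷ d) zero t = refl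
    ↾-update (a ∷ d) (suc i) t = cong (a ∷_) (↾-update d i t)

    ↾-supp : (d : Vec ℕ n) (R : Subset n) → supp d ⊆ R → d ↾ R ≡ d
    ↾-supp [] [] _ = refl
    ↾-supp (a ∷ d) (true ∷ R) s = cong (a ∷_) (↾-supp d R (drop-∷-⊆ s))
    ↾-supp (zero ∷ d) (false ∷ R) s = cong (0 ∷_) (↾-supp d R (drop-∷-⊆ s))
    ↾-supp (suc _ ∷ d) (false ∷ R) s with () ← s here

    weight-suc : (d : Vec ℕ n) (i : Fin n) (t : ℕ) (S : Subset n) →
      weight (d [ i ]≔ suc t) S ≤ suc (weight (d [ i ]≔ t) S)
    weight-suc (a ∷ d) zero t (true ∷ S) = ≤-refl
    weight-suc (a ∷ d) zero t (false ∷ S) = n≤1+n _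
    weight-suc (a ∷ d) (suc i) t (true ∷ S) =
      ≤-trans (+-monoʳ-≤ a (weight-suc d i t S)) (≤-reflexive (+-suc a _))
    weight-suc (a ∷ d) (suc i) t (false ∷ S) = weight-suc d i t S

    supp-update : (d : Vec ℕ n) (i : Fin n) (t : ℕ) {A : Subset n} → i ∈ A →
      supp d ≡ A ∩ ∁ ⁅ i ⁆ → supp (d [ i ]≔ suc t) ≡ A
    supp-update (a ∷ d) zero t {_ ∷ A} here eq =
      cong (true ∷_) (trans (proj₂ (∷-injective eq)) (trans (cong (A ∩_) (lem _)) (∩-identityʳ A)))
      where
      lem : ∀ n → ∁ (⊥ {n}) ≡ ⊤
      lem zero = refl
      lem (suc n) = cong (true ∷_) (lem n)
    supp-update (a ∷ d) (suc i) t {b ∷ A} (there i∈A) eq = cong₂ _∷_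
      (trans (proj₁ (∷-injective eq)) (∧-identityʳ b))
      (supp-update d i t i∈A (proj₂ (∷-injective eq)))

    lookup-update : (d : Vec ℕ n) (i : Fin n) (t : ℕ) → lookup (d [ i ]≔ t) i ≡ t
    lookup-update d i t = lookup∘updateAt i d

    ↾∁⁅⁆-unique : (d d′ : Vec ℕ n) (i : Fin n) → d ↾ ∁ ⁅ i ⁆ ≡ d′ ↾ ∁ ⁅ i ⁆ → lookup d i ≡ lookup d′ i → d ≡ d′
    ↾∁⁅⁆-unique (a ∷ d) (b ∷ d′) zero p refl = cong (a ∷_) (lem d d′ (proj₂ (∷-injective p)))
      where
      lem : ∀ {n} (d d′ : Vec ℕ n) → d ↾ ∁ ⊥ ≡ d′ ↾ ∁ ⊥ → d ≡ d′
      lem [] [] _ = refl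
      lem (a ∷ d) (b ∷ d′) p = cong₂ _∷_ (proj₁ (∷-injective p)) (lem d d′ (proj₂ (∷-injective p)))
    ↾∁⁅⁆-unique (a ∷ d) (b ∷ d′) (suc i) p q =
      cong₂ _∷_ (proj₁ (∷-injective p)) (↾∁⁅⁆-unique d d′ i (proj₂ (∷-injective p)) q)

    -- The vectors coincide off `i`, so equality at `R` for `d` against the bound at `R` for `d′`
    -- compares the two entries. Used in both directions, it recovers the deleted entry and makes
    -- deletion injective.
    minTight-maximal : ∀ {ρ : Subset n → ℕ} {d d′ R R′ i} → MinTight ρ d R → i ∈ R → MinTight ρ d′ R′ →
      d ↾ ∁ ⁅ i ⁆ ≡ d′ ↾ ∁ ⁅ i ⁆ → lookup d′ i ≤ lookup d i
    minTight-maximal {ρ = ρ} {d} {d′} {R} {i = i} p i∈R p′ eq = +-cancelʳ-≤ (weight d (R ∩ ∁ ⁅ i ⁆)) _ _ (begin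
      lookup d′ i + weight d (R ∩ ∁ ⁅ i ⁆)     ≡⟨ cong (lookup d′ i +_) (weight-↾ d (∁ ⁅ i ⁆) R) ⟨
      lookup d′ i + weight (d ↾ ∁ ⁅ i ⁆) R     ≡⟨ cong (λ e → lookup d′ i + weight e R) eq ⟩
      lookup d′ i + weight (d′ ↾ ∁ ⁅ i ⁆) R    ≡⟨ cong (lookup d′ i +_) (weight-↾ d′ (∁ ⁅ i ⁆) R) ⟩
      lookup d′ i + weight d′ (R ∩ ∁ ⁅ i ⁆)    ≡⟨ weight-insert d′ i∈R ⟨
      weight d′ R                              ≤⟨ p′ .bound R ⟩
      suc (ρ R)                                ≡⟨ p .tight ⟨
      weight d R                               ≡⟨ weight-insert d i∈R ⟩
      lookup d i + weight d (R ∩ ∁ ⁅ i ⁆)      ∎)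
      where open ≤-Reasoning

    -- Hall's condition at `⁅ i ⁆` caps the entry, so raising it step by step must break the
    -- condition.
    last-Hall : ∀ {ρ : Subset n → ℕ} (d : Vec ℕ n) (i : Fin n) k → ρ ⁅ i ⁆ < k → Hall ρ (d [ i ]≔ 0) →
      ∃[ t ] Hall ρ (d [ i ]≔ t) × ¬ Hall ρ (d [ i ]≔ suc t)
    last-Hall {ρ = ρ} d i k ρ<k h₀ = go k 0 (subst (ρ ⁅ i ⁆ <_) (sym (+-identityʳ k)) ρ<k) h₀
      where
      -- `k` is fuel: `k + t` stays constant, so when `k` reaches zero the entry `t` already exceeds
      -- `ρ ⁅ i ⁆`.
      go : ∀ k t → ρ ⁅ i ⁆ < k + t → Hall ρ (d [ i ]≔ t) → ∃[ t ] Hall ρ (d [ i ]≔ t) × ¬ Hall ρ (d [ i ]≔ suc t)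
      go zero t lt h = contradiction (<-≤-trans lt (subst (_≤ ρ ⁅ i ⁆)
        (trans (weight-⁅⁆ (d [ i ]≔ t) i) (lookup-update d i t)) (h ⁅ i ⁆))) (<-irrefl refl)
      go (suc k) t lt h with Hall? ρ (d [ i ]≔ suc t)
      ... | no ¬h  = t , h , ¬h
      ... | yes h′ = go k (suc t) (subst (ρ ⁅ i ⁆ <_) (sym (+-suc k t)) lt) h′

    ¬Hall⇒ : ∀ {ρ : Subset n → ℕ} {d} → ¬ Hall ρ d → ∃[ S ] ρ S < weight d S
    ¬Hall⇒ {ρ = ρ} {d} ¬h with anySubset? (λ S → ρ S <? weight d S)
    ... | yes p = p
    ... | no ¬p = contradiction (λ S → ≮⇒≥ λ lt → ¬p (S , lt)) ¬h

  demandTheory : CountingTheory n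
  demandTheory {n} = record
    { N        = λ H A → ∣ demandHallᴱ H A ∣
    ; g        = λ H A R → ∣ demandTightᴱ H A R ∣
    ; nil-⊥    = ∣∣-cong (demandHallᴱ [] ⊥) (oneᴱ (Vec.replicate n 0))
                   (λ (eq , _) → zeros _ eq)
                   (λ where refl → supp-zeros n , λ S → ≤-reflexive (weight-zeros S))
    ; nil      = λ {A} (i , i∈A) → ∣∣≡0 (demandHallᴱ [] A) λ {d} (eq , h) →
                   i∉ d (subst (i ∈_) (sym eq) i∈A)
                     (n≤0⇒n≡0 (subst (_≤ 0) (weight-⁅⁆ d i) (h ⁅ i ⁆)))
    ; cons     = cons
    ; contract = contract
    ; delete   = delete
    ; support  = λ H {A} {R} R⊈A → ∣∣≡0 (demandTightᴱ H A R) λ (eq , p) →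
                   R⊈A (subst (R ⊆_) eq (minTight⊆supp (cover-polymatroid H ⊤) p))
    }
    where
    i∉ : ∀ {n i} (d : Vec ℕ n) → i ∈ supp d → lookup d i ≢ 0
    i∉ (suc _ ∷ d) here ()
    i∉ (_ ∷ d) (there i∈) = i∉ d i∈

    cons : ∀ {m} I (H : Family m n) A → ∣ demandHallᴱ (I ∷ H) A ∣ ≡
      ∣ demandHallᴱ H A ∣ + sum (List.map (λ R → ∣ demandTightᴱ H A R ∣) (meeting I .elements))
    cons I H A = begin
      ∣ demandHallᴱ (I ∷ H) A ∣ ≡⟨ ∣∣-bijection (demandHallᴱ (I ∷ H) A) (E ⊎ᴱ F) [ id , proj₂ ]′
                                     (λ {y} → to {y}) inj from ⟩
      ∣ E ⊎ᴱ F ∣               ≡⟨ ∣⊎ᴱ∣ E F ⟩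
      ∣ E ∣ + ∣ F ∣           ≡⟨ cong (∣ E ∣ +_) (∣Σᴱ∣ (demandTightᴱ H A) (meeting I)) ⟩
      ∣ E ∣ + _                ∎
      where
      open ≡-Reasoning
      P = cover-polymatroid H ⊤
      E = demandHallᴱ H A
      F = Σᴱ (demandTightᴱ H A) (meeting I)
      Q : Pred (Vec ℕ n ⊎ Subset n × Vec ℕ n) _
      Q = [ DemandHall H A , (λ (R , d) → meets I R ≡ true × DemandTight H A R d) ]′
      to : ∀ {y} → Q y → DemandHall (I ∷ H) A ([ id , proj₂ ]′ y)
      to {inj₁ d} (eq , h) = eq , hall-insert⁺ˡ P {d} I h
      to {inj₂ (R , d)} (mt , eq , p) = eq , hall-insert⁺ʳ P I mt p
      inj : ∀ {y y′} → Q y → Q y′ → [ id , proj₂ ]′ y ≡ [ id , proj₂ ]′ y′ → y ≡ y′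
      inj {inj₁ _} {inj₁ _} _ _ refl = refl
      inj {inj₁ _} {inj₂ _} (_ , h) (_ , _ , p) refl = contradiction h (minTight⇒¬Hall p)
      inj {inj₂ _} {inj₁ _} (_ , _ , p) (_ , h) refl = contradiction h (minTight⇒¬Hall p)
      inj {inj₂ _} {inj₂ _} (_ , _ , p) (_ , _ , p′) refl = cong (λ R → inj₂ (R , _)) (minTight-unique p p′)
      from : ∀ {d} → DemandHall (I ∷ H) A d → ∃[ y ] Q y × d ≡ [ id , proj₂ ]′ y
      from {d} (eq , h) with hall-insert⁻ P {d} I h
      ... | inj₁ h′           = inj₁ d , (eq , h′) , refl
      ... | inj₂ (R , mt , p) = inj₂ (R , d) , (mt , eq , p) , refl

    contract : ∀ {m} (H : Family m n) {A R} → R ⊆ A →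
      ∣ demandTightᴱ H A R ∣ ≡ ∣ demandTightᴱ H R R ∣ * ∣ demandHallᴱ (H ∖∖ R) (A ∩ ∁ R) ∣
    contract H {A} {R} R⊆A = sym (trans (sym (∣×ᴱ∣ E F))
      (∣∣-bijection (E ×ᴱ F) (demandTightᴱ H A R) (λ d → d ↾ R , d ↾ ∁ R) to
        (λ {d} {d′} _ _ eq → ↾-split-unique d d′ R (,-injectiveˡ eq) (,-injectiveʳ eq)) from))
      where
      P = cover-polymatroid H ⊤
      E = demandTightᴱ H R R
      F = demandHallᴱ (H ∖∖ R) (A ∩ ∁ R)
      to : ∀ {d} → DemandTight H A R d → DemandTight H R R (d ↾ R) × DemandHall (H ∖∖ R) (A ∩ ∁ R) (d ↾ ∁ R)
      to {d} (refl , p) with p₁ , h ← minTight-split⁻ P (cover-∖∖ H ⊤ R) p =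
        (trans (supp-↾ d R) (⊆⇒∩≡ʳ R⊆A) , p₁) , (supp-↾ d (∁ R) , h)
      from : ∀ {(d₁ , d₂) : Vec ℕ n × Vec ℕ n} → DemandTight H R R d₁ × DemandHall (H ∖∖ R) (A ∩ ∁ R) d₂ →
        ∃[ d ] DemandTight H A R d × (d₁ , d₂) ≡ (d ↾ R , d ↾ ∁ R)
      from {d₁ , d₂} ((s₁ , p) , (s₂ , h))
        with ↾-merge d₁ d₂ R (⊆-reflexive s₁) (p∩q⊆q A (∁ R) ∘ ⊆-reflexive s₂)
      ... | d , refl , refl = d , (∩∁-unique _ A R
              (trans (sym (supp-↾ d R)) (trans s₁ (sym (⊆⇒∩≡ʳ R⊆A))))
              (trans (sym (supp-↾ d (∁ R))) s₂) ,
            minTight-split⁺ P (cover-∖∖ H ⊤ R) p h) , refl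

    -- The inverse of zeroing entry `i` raises it to the first value that breaks Hall's condition.
    -- Each unit adds at most one to any weight, so the excess is then exactly one; that value is
    -- positive, so the support becomes `A`.
    delete : ∀ {m} (H : Family m n) {A i} → i ∈ A → ∣ demandHallᴱ H (A ∩ ∁ ⁅ i ⁆) ∣ ≡
      sum (List.map (λ R → ∣ demandTightᴱ H A R ∣) (meeting ⁅ i ⁆ .elements))
    delete H {A} {i} i∈A = trans
      (∣∣-bijection (demandHallᴱ H (A ∩ ∁ ⁅ i ⁆)) (Σᴱ (demandTightᴱ H A) (meeting ⁅ i ⁆))
        (λ (R , d) → d ↾ ∁ ⁅ i ⁆) to inj from)
      (∣Σᴱ∣ (demandTightᴱ H A) (meeting ⁅ i ⁆))
      where
      ρ = cover H ⊤
      P = cover-polymatroid H ⊤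
      Q : Pred (Subset n × Vec ℕ n) _
      Q (R , d) = meets ⁅ i ⁆ R ≡ true × DemandTight H A R d
      to : ∀ {y@(R , d) : Subset n × Vec ℕ n} → Q y → DemandHall H (A ∩ ∁ ⁅ i ⁆) (d ↾ ∁ ⁅ i ⁆)
      to {R , d} (mt , refl , p) = supp-↾ d (∁ ⁅ i ⁆) , hall-delete P (meets-⁅⁆⁻ R mt) p
      inj : ∀ {y@(R , d) y′@(R′ , d′) : Subset n × Vec ℕ n} → Q y → Q y′ → d ↾ ∁ ⁅ i ⁆ ≡ d′ ↾ ∁ ⁅ i ⁆ → y ≡ y′
      inj {R , d} {R′ , d′} (mt , _ , p) (mt′ , _ , p′) eq
        with ↾∁⁅⁆-unique d d′ i eq (≤-antisym (minTight-maximal p′ (meets-⁅⁆⁻ R′ mt′) p (sym eq))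
                                                 (minTight-maximal p (meets-⁅⁆⁻ R mt) p′ eq))
      ... | refl = cong (_, d) (minTight-unique p p′)
      from : ∀ {d} → DemandHall H (A ∩ ∁ ⁅ i ⁆) d → ∃[ y ] Q y × d ≡ proj₂ y ↾ ∁ ⁅ i ⁆
      from {d} (eq , h) = case last-Hall {ρ = ρ} d i (suc (ρ ⁅ i ⁆)) ≤-refl (subst (Hall ρ) (sym d≡) h) of λ where
          (t , hₜ , ¬h) → go t hₜ (¬Hall⇒ {ρ = ρ} {d [ i ]≔ suc t} ¬h)
        where
        i∉supp : i ∉ supp d
        i∉supp i∈ = x∈p⇒x∉∁p (x∈⁅x⁆ i) (p∩q⊆q A (∁ ⁅ i ⁆) (subst (i ∈_) eq i∈))
        d≡ : d [ i ]≔ 0 ≡ d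
        d≡ = at-zero d i (∉supp {d = d} i∉supp)
        restrict : ∀ t → (d [ i ]≔ t) ↾ ∁ ⁅ i ⁆ ≡ d
        restrict t = trans (↾-update d i t)
          (↾-supp d (∁ ⁅ i ⁆) (λ x∈ → p∩q⊆q A (∁ ⁅ i ⁆) (subst (_ ∈_) eq x∈)))
        go : ∀ t → Hall ρ (d [ i ]≔ t) → ∃[ S ] ρ S < weight (d [ i ]≔ suc t) S →
          ∃[ y ] Q y × d ≡ proj₂ y ↾ ∁ ⁅ i ⁆
        go t hₜ (S , lt) =
          case minTight-delete {d = d [ i ]≔ suc t} P b (≤-antisym (b S) lt)
                 (subst (Hall ρ) (sym (restrict (suc t))) h) of λ where
            (R , i∈R , p) → (R , d [ i ]≔ suc t) ,
              (meets-⁅⁆⁺ R i∈R , supp-update d i t i∈A eq , p) , sym (restrict (suc t))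
          where
          b : ∀ S → weight (d [ i ]≔ suc t) S ≤ suc (ρ S)
          b S = ≤-trans (weight-suc d i t S) (s≤s (hₜ S))

  -- Second count: sets of left vertices perfectly matched with `A`.

  TransversalHall : Family m n → Subset n → Pred (Subset m) _
  TransversalHall H A T = ∥ T ∥ ≡ ∥ A ∥ × Hall (cover H T) (𝟙 A)

  -- Here `T` is one vertex short of a perfect matching with `A`; a new left vertex completes it
  -- when its neighbourhood meets `R`.
  TransversalTight : Family m n → Subset n → Subset n → Pred (Subset m) _
  TransversalTight H A R T = suc ∥ T ∥ ≡ ∥ A ∥ × MinTight (cover H T) (𝟙 A) R

  module _ (H : Family m n) (A : Subset n) where

    transversalHallᴱ : Enumeration (TransversalHall H A)
    transversalHallᴱ = subsetᴱ λ T → (∥ T ∥ ≟ ∥ A ∥) ×-dec Hall? (cover H T) (𝟙 A)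

    transversalTightᴱ : ∀ R → Enumeration (TransversalTight H A R)
    transversalTightᴱ R = subsetᴱ λ T → (suc ∥ T ∥ ≟ ∥ A ∥) ×-dec MinTight? (cover H T) (𝟙 A) R

  private
    ∥A∩∁⁅i⁆∥ : ∀ {A : Subset n} {i} → i ∈ A → suc ∥ A ∩ ∁ ⁅ i ⁆ ∥ ≡ ∥ A ∥
    ∥A∩∁⁅i⁆∥ {A = A} {i} i∈A = begin
      suc ∥ A ∩ ∁ ⁅ i ⁆ ∥ ≡⟨ cong (_+ ∥ A ∩ ∁ ⁅ i ⁆ ∥) (trans (cong ∥_∥ eq) (∣⁅x⁆∣≡1 i)) ⟨
      ∥ A ∩ ⁅ i ⁆ ∥ + ∥ A ∩ ∁ ⁅ i ⁆ ∥ ≡⟨ ∥∥-split A ⁅ i ⁆ ⟩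
      ∥ A ∥ ∎
      where
      open ≡-Reasoning
      eq : A ∩ ⁅ i ⁆ ≡ ⁅ i ⁆
      eq = ⊆⇒∩≡ʳ λ x∈ → subst (_∈ A) (sym (x∈⁅y⁆⇒x≡y i x∈)) i∈A

    ∥∥≤cover : ∀ (H : Family m n) {T A} → Hall (cover H T) (𝟙 A) → ∥ A ∥ ≤ cover H T A
    ∥∥≤cover H {T} {A} h = subst (_≤ cover H T A) (weight-𝟙-self A) (h A)

    weight-𝟙-local : ∀ (R S : Subset n) → weight (𝟙 R) S ≡ weight (𝟙 R) (S ∩ R)
    weight-𝟙-local R S = begin
      weight (𝟙 R) S       ≡⟨ cong (λ B → weight (𝟙 B) S) (∩-idem R) ⟨
      weight (𝟙 (R ∩ R)) S ≡⟨ cong (λ d → weight d S) (𝟙-↾ R R) ⟨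
      weight (𝟙 R ↾ R) S   ≡⟨ weight-↾ (𝟙 R) R S ⟩
      weight (𝟙 R) (S ∩ R) ∎
      where open ≡-Reasoning

  transversalTheory : CountingTheory n
  transversalTheory {n} = record
    { N        = λ H A → ∣ transversalHallᴱ H A ∣
    ; g        = λ H A R → ∣ transversalTightᴱ H A R ∣
    ; nil-⊥    = ∣∣-cong (transversalHallᴱ [] (⊥ {n})) (vecᴱ boolᴱ 0)
                   (λ {T} _ → VAll.universal _ T)
                   (λ {T} _ → hall-⊥ T)
    ; nil      = λ {A} (i , i∈A) → ∣∣≡0 (transversalHallᴱ [] A) λ {T} (eq , _) →
                   contradiction (subst (0 <_) (sym (trans (sym (∥[]∥ T)) eq)) (<-≤-trans z<s (x∈p⇒∣p-x∣<∣p∣ i∈A))) λ ()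
    ; cons     = cons
    ; contract = contract
    ; delete   = delete
    ; support  = λ H {A} {R} R⊈A → ∣∣≡0 (transversalTightᴱ H A R) λ {T} (_ , p) →
                   R⊈A (subst (R ⊆_) (supp-𝟙 A) (minTight⊆supp (cover-polymatroid H T) p))
    }
    where
    ∥[]∥ : (T : Subset 0) → ∥ T ∥ ≡ 0
    ∥[]∥ [] = refl

    hall-⊥ : (T : Subset 0) → TransversalHall [] (⊥ {n}) T
    hall-⊥ [] = sym (∣⊥∣≡0 n) , λ S → ≤-trans (≤-reflexive (weight-𝟙 ⊥ S))
      (≤-trans (∣p∩q∣≤∣p∣ ⊥ S) (≤-reflexive (∣⊥∣≡0 n)))

    cons : ∀ {m} I (H : Family m n) A → ∣ transversalHallᴱ (I ∷ H) A ∣ ≡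
      ∣ transversalHallᴱ H A ∣ + sum (List.map (λ R → ∣ transversalTightᴱ H A R ∣) (meeting I .elements))
    cons {m} I H A = begin
      ∣ transversalHallᴱ (I ∷ H) A ∣ ≡⟨ ∣∣-bijection (transversalHallᴱ (I ∷ H) A) (E ⊎ᴱ F) π
                                           (λ {y} → to {y}) inj from ⟩
      ∣ E ⊎ᴱ F ∣               ≡⟨ ∣⊎ᴱ∣ E F ⟩
      ∣ E ∣ + ∣ F ∣           ≡⟨ cong (∣ E ∣ +_) (∣Σᴱ∣ (transversalTightᴱ H A) (meeting I)) ⟩
      ∣ E ∣ + _                ∎
      where
      open ≡-Reasoning
      E = transversalHallᴱ H A
      F = Σᴱ (transversalTightᴱ H A) (meeting I)
      π : Subset m ⊎ Subset n × Subset m → Subset (suc m)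
      π = [ false ∷_ , (λ (R , T) → true ∷ T) ]′
      Q : Pred (Subset m ⊎ Subset n × Subset m) _
      Q = [ TransversalHall H A , (λ (R , T) → meets I R ≡ true × TransversalTight H A R T) ]′
      to : ∀ {y} → Q y → TransversalHall (I ∷ H) A (π y)
      to {inj₁ T} q = q
      to {inj₂ (R , T)} (mt , eq , p) = eq , hall-insert⁺ʳ (cover-polymatroid H T) I mt p
      inj : ∀ {y y′} → Q y → Q y′ → π y ≡ π y′ → y ≡ y′
      inj {inj₁ _} {inj₁ _} _ _ eq = cong inj₁ (proj₂ (∷-injective eq))
      inj {inj₂ _} {inj₂ _} (_ , _ , p) (_ , _ , p′) refl = cong (λ R → inj₂ (R , _)) (minTight-unique p p′)
      from : ∀ {T} → TransversalHall (I ∷ H) A T → ∃[ y ] Q y × T ≡ π y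
      from {false ∷ T} q = inj₁ T , q , refl
      from {true ∷ T} (eq , h) with hall-insert⁻ (cover-polymatroid H T) {𝟙 A} I h
      ... | inj₂ (R , mt , p) = inj₂ (R , T) , (mt , eq , p) , refl
      -- Without the new left vertex, `T` has one element fewer than `A` and cannot satisfy Hall's
      -- condition at `A`.
      ... | inj₁ h′ = contradiction (≤-trans (≤-reflexive eq)
                        (≤-trans (∥∥≤cover H h′) (cover≤∥∥ H T A))) 1+n≰n

    -- Tightness at `R` says that exactly `∥ R ∥ - 1` vertices of `T` are adjacent to `R`. Cutting
    -- `T` along `N` thus leaves a part one short for `R` and a part of the size of `A ∩ ∁ R`.
    contract : ∀ {m} (H : Family m n) {A R} → R ⊆ A →
      ∣ transversalTightᴱ H A R ∣ ≡ ∣ transversalTightᴱ H R R ∣ * ∣ transversalHallᴱ (H ∖∖ R) (A ∩ ∁ R) ∣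
    contract {m} H {A} {R} R⊆A = sym (trans (sym (∣×ᴱ∣ E F))
      (∣∣-bijection (E ×ᴱ F) (transversalTightᴱ H A R) (λ T → T ∩ N , T ∩ ∁ N) to
        (λ {T} {T′} _ _ eq → ∩∁-unique T T′ N (,-injectiveˡ eq) (,-injectiveʳ eq)) from))
      where
      N = neighbours H R
      E = transversalTightᴱ H R R
      F = transversalHallᴱ (H ∖∖ R) (A ∩ ∁ R)
      A∩R≡R : A ∩ R ≡ R
      A∩R≡R = ⊆⇒∩≡ʳ R⊆A
      𝟙A↾R : 𝟙 A ↾ R ≡ 𝟙 R
      𝟙A↾R = trans (𝟙-↾ A R) (cong 𝟙 A∩R≡R)
      size : ∀ {T} → MinTight (cover H T) (𝟙 R) R → suc ∥ T ∩ N ∥ ≡ ∥ R ∥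
      size {T} p = begin
        suc ∥ T ∩ N ∥   ≡⟨ cong suc (cover≡∥∩∥ H T R) ⟨
        suc (cover H T R) ≡⟨ p .tight ⟨
        weight (𝟙 R) R  ≡⟨ weight-𝟙-self R ⟩
        ∥ R ∥ ∎
        where open ≡-Reasoning
      ∥A∥ : ∥ R ∥ + ∥ A ∩ ∁ R ∥ ≡ ∥ A ∥
      ∥A∥ = trans (cong (λ B → ∥ B ∥ + ∥ A ∩ ∁ R ∥) (sym A∩R≡R)) (∥∥-split A R)
      to : ∀ {T} → TransversalTight H A R T →
        TransversalTight H R R (T ∩ N) × TransversalHall (H ∖∖ R) (A ∩ ∁ R) (T ∩ ∁ N)
      to {T} (eq , p) with minTight-split⁻ (cover-polymatroid H T) (cover-∖∖ H T R) p
      ... | p₁ , h = (size p₁′ , minTight-local (cover-polymatroid H (T ∩ N)) (weight-𝟙-local R)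
                        (λ S⊆R → sym (cover-neighbours H T S⊆R)) p₁′)
                   , +-cancelˡ-≡ (suc ∥ T ∩ N ∥) _ _ size₂
                   , λ S → subst₂ _≤_ (cong (λ d → weight d S) (𝟙-↾ A (∁ R))) (sym (cover-∖∖-neighbours H T R S)) (h S)
        where
        p₁′ : MinTight (cover H T) (𝟙 R) R
        p₁′ = subst (λ d → MinTight (cover H T) d R) 𝟙A↾R p₁
        size₂ : suc ∥ T ∩ N ∥ + ∥ T ∩ ∁ N ∥ ≡ suc ∥ T ∩ N ∥ + ∥ A ∩ ∁ R ∥
        size₂ = begin
          suc (∥ T ∩ N ∥ + ∥ T ∩ ∁ N ∥) ≡⟨ cong suc (∥∥-split T N) ⟩
          suc ∥ T ∥                     ≡⟨ eq ⟩
          ∥ A ∥                         ≡⟨ ∥A∥ ⟨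
          ∥ R ∥ + ∥ A ∩ ∁ R ∥           ≡⟨ cong (_+ ∥ A ∩ ∁ R ∥) (size p₁′) ⟨
          suc ∥ T ∩ N ∥ + ∥ A ∩ ∁ R ∥   ∎
          where open ≡-Reasoning
      from : ∀ {(T₁ , T₂) : Subset m × Subset m} →
        TransversalTight H R R T₁ × TransversalHall (H ∖∖ R) (A ∩ ∁ R) T₂ →
        ∃[ T ] TransversalTight H A R T × (T₁ , T₂) ≡ (T ∩ N , T ∩ ∁ N)
      from {T₁ , T₂} ((eq₁ , p) , (eq₂ , h)) = T , (sizeT , tightT) , cong₂ _,_ (sym T∩N) (sym T∩∁N)
        where
        T = T₁ ∪ T₂
        -- Both `T₁` and `T₁ ∩ N` have size `∥ R ∥ - 1`, the latter by tightness at `R`.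
        T₁⊆ : T₁ ∩ N ≡ T₁
        T₁⊆ = ∩-absorbs T₁ N (≤-reflexive (suc-injective (trans eq₁ (sym (size p)))))
        -- Vertices in `N` have empty neighbourhoods in `H ∖∖ R`, so Hall's condition at `A ∩ ∁ R`
        -- already needs `∥ T₂ ∥` vertices outside `N`.
        T₂⊆ : T₂ ∩ ∁ N ≡ T₂
        T₂⊆ = ∩-absorbs T₂ (∁ N) (begin
          ∥ T₂ ∥ ≡⟨ eq₂ ⟩
          ∥ A ∩ ∁ R ∥ ≤⟨ ∥∥≤cover (H ∖∖ R) h ⟩
          cover (H ∖∖ R) T₂ (A ∩ ∁ R) ≡⟨ cover-∖∖-neighbours H T₂ R (A ∩ ∁ R) ⟨
          cover (H ∖∖ R) (T₂ ∩ ∁ N) (A ∩ ∁ R) ≤⟨ cover≤∥∥ (H ∖∖ R) (T₂ ∩ ∁ N) _ ⟩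
          ∥ T₂ ∩ ∁ N ∥ ∎)
          where open ≤-Reasoning
        T∩N : T ∩ N ≡ T₁
        T∩N = ∪-∩ˡ T₁ T₂ N T₁⊆ T₂⊆
        T∩∁N : T ∩ ∁ N ≡ T₂
        T∩∁N = ∪-∩ʳ T₁ T₂ N T₁⊆ T₂⊆
        sizeT : suc ∥ T ∥ ≡ ∥ A ∥
        sizeT = begin
          suc ∥ T ∥ ≡⟨ cong suc (∥∥-split T N) ⟨
          suc (∥ T ∩ N ∥ + ∥ T ∩ ∁ N ∥) ≡⟨ cong₂ (λ B C → suc (∥ B ∥ + ∥ C ∥)) T∩N T∩∁N ⟩
          suc ∥ T₁ ∥ + ∥ T₂ ∥ ≡⟨ cong₂ _+_ eq₁ eq₂ ⟩
          ∥ R ∥ + ∥ A ∩ ∁ R ∥ ≡⟨ ∥A∥ ⟩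
          ∥ A ∥ ∎
          where open ≡-Reasoning
        tightT : MinTight (cover H T) (𝟙 A) R
        tightT = minTight-split⁺ (cover-polymatroid H T) (cover-∖∖ H T R)
          (subst (λ d → MinTight (cover H T) d R) (sym 𝟙A↾R)
            (minTight-local (cover-polymatroid H T) (weight-𝟙-local R)
              (λ {S} S⊆R → trans (cong (λ B → cover H B S) (sym T∩N)) (cover-neighbours H T S⊆R)) p))
          (λ S → subst₂ _≤_ (cong (λ d → weight d S) (sym (𝟙-↾ A (∁ R))))
            (trans (cong (λ B → cover (H ∖∖ R) B S) (sym T∩∁N)) (cover-∖∖-neighbours H T R S)) (h S))

    -- `T` itself does not change. Restoring `i` adds at most one to every weight, and `A` does have
    -- excess one because `T` is smaller than `A`; the least tight set then contains `i`.
    delete : ∀ {m} (H : Family m n) {A i} → i ∈ A → ∣ transversalHallᴱ H (A ∩ ∁ ⁅ i ⁆) ∣ ≡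
      sum (List.map (λ R → ∣ transversalTightᴱ H A R ∣) (meeting ⁅ i ⁆ .elements))
    delete {m} H {A} {i} i∈A = trans
      (∣∣-bijection (transversalHallᴱ H (A ∩ ∁ ⁅ i ⁆)) (Σᴱ (transversalTightᴱ H A) (meeting ⁅ i ⁆)) proj₂
        to (λ where (_ , _ , p) (_ , _ , p′) refl → cong (_, _) (minTight-unique p p′)) from)
      (∣Σᴱ∣ (transversalTightᴱ H A) (meeting ⁅ i ⁆))
      where
      Q : Pred (Subset n × Subset m) _
      Q (R , T) = meets ⁅ i ⁆ R ≡ true × TransversalTight H A R T
      to : ∀ {y} → Q y → TransversalHall H (A ∩ ∁ ⁅ i ⁆) (proj₂ y)
      to {R , T} (mt , eq , p) = suc-injective (trans eq (sym (∥A∩∁⁅i⁆∥ i∈A)))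
        , subst (Hall (cover H T)) (𝟙-↾ A (∁ ⁅ i ⁆)) (hall-delete (cover-polymatroid H T) (meets-⁅⁆⁻ R mt) p)
      from : ∀ {T} → TransversalHall H (A ∩ ∁ ⁅ i ⁆) T → ∃[ y ] Q y × T ≡ proj₂ y
      from {T} (eq , h) =
        case minTight-delete {d = 𝟙 A} P b (≤-antisym (b A) t) h′ of λ where
          (R , i∈R , p) → (R , T) , (meets-⁅⁆⁺ R i∈R , eq′ , p) , refl
        where
        P = cover-polymatroid H T
        h′ : Hall (cover H T) (𝟙 A ↾ ∁ ⁅ i ⁆)
        h′ = subst (Hall (cover H T)) (sym (𝟙-↾ A (∁ ⁅ i ⁆))) h
        eq′ : suc ∥ T ∥ ≡ ∥ A ∥
        eq′ = trans (cong suc eq) (∥A∩∁⁅i⁆∥ i∈A)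
        open ≤-Reasoning
        t : suc (cover H T A) ≤ weight (𝟙 A) A
        t = begin
          suc (cover H T A) ≤⟨ s≤s (cover≤∥∥ H T A) ⟩
          suc ∥ T ∥ ≡⟨ eq′ ⟩
          ∥ A ∥ ≡⟨ weight-𝟙-self A ⟨
          weight (𝟙 A) A ∎
        b : ∀ S → weight (𝟙 A) S ≤ suc (cover H T S)
        b S = begin
          weight (𝟙 A) S ≡⟨ weight-split (𝟙 A) S ⁅ i ⁆ ⟨
          weight (𝟙 A) (S ∩ ⁅ i ⁆) + weight (𝟙 A) (S ∩ ∁ ⁅ i ⁆) ≤⟨ +-mono-≤ one rest ⟩
          suc (cover H T S) ∎
          where
          one : weight (𝟙 A) (S ∩ ⁅ i ⁆) ≤ 1
          one = begin
            weight (𝟙 A) (S ∩ ⁅ i ⁆) ≡⟨ weight-𝟙 A (S ∩ ⁅ i ⁆) ⟩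
            ∥ A ∩ S ∩ ⁅ i ⁆ ∥ ≤⟨ p⊆q⇒∣p∣≤∣q∣ (p∩q⊆q S ⁅ i ⁆ ∘ p∩q⊆q A (S ∩ ⁅ i ⁆)) ⟩
            ∥ ⁅ i ⁆ ∥ ≡⟨ ∣⁅x⁆∣≡1 i ⟩
            1 ∎
          rest : weight (𝟙 A) (S ∩ ∁ ⁅ i ⁆) ≤ cover H T S
          rest = subst (_≤ cover H T S) (weight-↾ (𝟙 A) (∁ ⁅ i ⁆) S) (h′ S)

  ∣demand∣≡∣transversal∣ : (H : Family m n) (A : Subset n) →
    ∣ demandHallᴱ H A ∣ ≡ ∣ transversalHallᴱ H A ∣
  ∣demand∣≡∣transversal∣ = counting-unique demandTheory transversalTheory

  -- Symmetry of matched pairs under exchanging the sides.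

  ∈neighbours⁺ : ∀ (H : Family m n) {j i S} → i ∈ lookup H j → i ∈ S → j ∈ neighbours H S
  ∈neighbours⁺ H {j} {i} {S} i∈ i∈S =
    lookup⇒[]= j _ (trans (lookup-map j _ H) (meets⁺ (lookup H j) S i∈ i∈S))

  ∈neighbours⁻ : ∀ (H : Family m n) {j S} → j ∈ neighbours H S → ∃[ i ] i ∈ lookup H j × i ∈ S
  ∈neighbours⁻ H {j} {S} j∈ = meets⁻ (lookup H j) S (trans (sym (lookup-map j _ H)) ([]=⇒lookup j∈))

  -- Apply Hall's condition to the complement of the neighbourhood.
  transversalHall-sym : ∀ (H : Family m n) (H* : Family n m) → (∀ {i j} → i ∈ lookup H j → j ∈ lookup H* i) →
    ∀ {A T} → TransversalHall H A T → TransversalHall H* T A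
  transversalHall-sym H H* adj {A} {T} (eq , h) = sym eq , λ S → +-cancelʳ-≤ ∥ A ∩ ∁ (N* S) ∥ _ _ (begin
    weight (𝟙 T) S + ∥ A ∩ ∁ (N* S) ∥ ≡⟨ cong₂ _+_ (weight-𝟙 T S) (sym (weight-𝟙 A (∁ (N* S)))) ⟩
    ∥ T ∩ S ∥ + weight (𝟙 A) (∁ (N* S)) ≤⟨ +-monoʳ-≤ ∥ T ∩ S ∥ (h (∁ (N* S))) ⟩
    ∥ T ∩ S ∥ + cover H T (∁ (N* S)) ≡⟨ cong (∥ T ∩ S ∥ +_) (cover≡∥∩∥ H T (∁ (N* S))) ⟩
    ∥ T ∩ S ∥ + ∥ T ∩ neighbours H (∁ (N* S)) ∥ ≤⟨ +-monoʳ-≤ ∥ T ∩ S ∥ (p⊆q⇒∣p∣≤∣q∣ (disjoint S)) ⟩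
    ∥ T ∩ S ∥ + ∥ T ∩ ∁ S ∥ ≡⟨ ∥∥-split T S ⟩
    ∥ T ∥ ≡⟨ eq ⟩
    ∥ A ∥ ≡⟨ ∥∥-split A (N* S) ⟨
    ∥ A ∩ N* S ∥ + ∥ A ∩ ∁ (N* S) ∥ ≡⟨ cong (_+ ∥ A ∩ ∁ (N* S) ∥) (cover≡∥∩∥ H* A S) ⟨
    cover H* A S + ∥ A ∩ ∁ (N* S) ∥ ∎)
    where
    open ≤-Reasoning
    N* = neighbours H*
    disjoint : ∀ S → T ∩ neighbours H (∁ (N* S)) ⊆ T ∩ ∁ S
    disjoint S j∈ with j∈T , j∈N ← x∈p∩q⁻ T _ j∈ with i , i∈ , i∈∁ ← ∈neighbours⁻ H j∈N =
      x∈p∩q⁺ (j∈T , x∉p⇒x∈∁p λ j∈S → x∈∁p⇒x∉p i∈∁ (∈neighbours⁺ H* (adj i∈) j∈S))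

  family : BipartiteGraph m n → Family m n
  family G = Vec.tabulate I[ G ]

  family-swap : ∀ (G : BipartiteGraph m n) {i j} → i ∈ lookup (family G) j → j ∈ lookup (family (swap G)) i
  family-swap G {i} {j} i∈ = lookup⇒[]= j _ (begin
    lookup (lookup (family (swap G)) i) j ≡⟨ cong (λ v → lookup v j) (lookup∘tabulate I[ swap G ] i) ⟩
    lookup (I[ swap G ] i) j ≡⟨ lookup∘tabulate _ j ⟩
    adjacent G j i ≡⟨ lookup∘tabulate (adjacent G j) i ⟨
    lookup (I[ G ] j) i ≡⟨ cong (λ v → lookup v i) (lookup∘tabulate I[ G ] j) ⟨
    lookup (lookup (family G) j) i ≡⟨ []=⇒lookup i∈ ⟩
    true ∎)
    where open ≡-Reasoning

  -- Integer points with Hall's condition and their sign choices.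

  ∣_∣ⱽ : Vec ℤ n → Vec ℕ n
  ∣_∣ⱽ = Vec.map ℤ.∣_∣

  LatticeHall : Family m n → Pred (Vec ℤ n) _
  LatticeHall H x = Hall (cover H ⊤) ∣ x ∣ⱽ

  boundedℤᴱ : ∀ k → Enumeration (λ z → ℤ.∣ z ∣ ≤ k)
  boundedℤᴱ k = imageᴱ [ ℤ.+_ , -[1+_] ]′ inj (λ {x} → to {x}) from (≤ᴱ k ⊎ᴱ <ᴱ)
    where
    -- The bound is strict here because `-[1+ a ]` has absolute value `suc a`.
    <ᴱ : Enumeration (_< k)
    <ᴱ = record { elements = upTo k ; unique = Unique.upTo⁺ k ; sound = All.tabulate ∈-upTo⁻ ; complete = ∈-upTo⁺ }
    inj : ∀ {x x′ : ℕ ⊎ ℕ} → [ ℤ.+_ , -[1+_] ]′ x ≡ [ ℤ.+_ , -[1+_] ]′ x′ → x ≡ x′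
    inj {inj₁ _} {inj₁ _} refl = refl
    inj {inj₂ _} {inj₂ _} refl = refl
    to : ∀ {x} → [ _≤ k , _< k ]′ x → ℤ.∣ [ ℤ.+_ , -[1+_] ]′ x ∣ ≤ k
    to {inj₁ _} p = p
    to {inj₂ _} p = p
    from : ∀ {z} → ℤ.∣ z ∣ ≤ k → ∃[ x ] [ _≤ k , _< k ]′ x × z ≡ [ ℤ.+_ , -[1+_] ]′ x
    from {ℤ.+ a}      p = inj₁ a , p , refl
    from { -[1+ a ]} p = inj₂ a , p , refl

  latticeHallᴱ : (H : Family m n) → Enumeration (LatticeHall H)
  latticeHallᴱ {m} {n} H = select (vecᴱ (boundedℤᴱ m) n) (λ x → Hall? (cover H ⊤) ∣ x ∣ⱽ)
    λ {x} h → lookup⁻ λ i → subst (_≤ m) (lookup-map i ℤ.∣_∣ x)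
      (lookup≤ ∣ x ∣ⱽ m (λ S → ≤-trans (h S) (≤-trans (cover≤∥∥ H ⊤ S) (∣p∣≤n ⊤))) i)

  absᴱ : ∀ k → Enumeration (λ z → ℤ.∣ z ∣ ≡ k)
  absᴱ zero = respᴱ (λ where refl → refl) ∣i∣≡0⇒i≡0 (oneᴱ 0ℤ)
  absᴱ (suc k) = record
    { elements = ℤ.+ suc k ∷ -[1+ k ] ∷ []
    ; unique   = ((λ ()) ∷ []) ∷ [] ∷ []
    ; sound    = refl ∷ refl ∷ []
    ; complete = λ {z} → member z
    }
    where
    member : ∀ z → ℤ.∣ z ∣ ≡ suc k → z ∈ˡ ℤ.+ suc k ∷ -[1+ k ] ∷ []
    member (ℤ.+ _)  refl = here refl
    member -[1+ _ ] refl = there (here refl)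

  absⱽᴱ : (d : Vec ℕ n) → Enumeration (λ x → ∣ x ∣ⱽ ≡ d)
  absⱽᴱ [] = respᴱ (λ where refl → refl) (λ {x} → nil x) (oneᴱ [])
    where
    nil : (x : Vec ℤ 0) → ∣ x ∣ⱽ ≡ [] → x ≡ []
    nil [] _ = refl
  absⱽᴱ (k ∷ d) = imageᴱ (λ (z , x) → z ∷ x)
    (λ eq → case ∷-injective eq of λ (e , e′) → cong₂ _,_ e e′)
    (λ (e , e′) → cong₂ _∷_ e e′)
    (λ {x} → split x)
    (absᴱ k ×ᴱ absⱽᴱ d)
    where
    split : ∀ x → ∣ x ∣ⱽ ≡ k ∷ d → ∃[ (z , y) ] (ℤ.∣ z ∣ ≡ k × ∣ y ∣ⱽ ≡ d) × x ≡ z ∷ y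
    split (z ∷ x) eq = (z , x) , ∷-injective eq , refl

  ∣absⱽᴱ∣ : (d : Vec ℕ n) → ∣ absⱽᴱ d ∣ ≡ 2 ^ ∥ supp d ∥
  ∣absⱽᴱ∣ [] = refl
  ∣absⱽᴱ∣ (k ∷ d) = trans (length-map _ ((absᴱ k ×ᴱ absⱽᴱ d) .elements))
    (trans (∣×ᴱ∣ (absᴱ k) (absⱽᴱ d)) (trans (cong (∣ absᴱ k ∣ *_) (∣absⱽᴱ∣ d)) (lem k)))
    where
    lem : ∀ k → ∣ absᴱ k ∣ * 2 ^ ∥ supp d ∥ ≡ 2 ^ ∥ isPositive k ∷ supp d ∥
    lem zero    = +-identityʳ _
    lem (suc _) = refl

  s≡∥supp∥ : (x : Vec ℤ n) → s x ≡ ∥ supp ∣ x ∣ⱽ ∥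
  s≡∥supp∥ [] = refl
  s≡∥supp∥ (ℤ.+ zero ∷ x) = s≡∥supp∥ x
  s≡∥supp∥ (ℤ.+ suc _ ∷ x) = cong suc (s≡∥supp∥ x)
  s≡∥supp∥ (-[1+ _ ] ∷ x) = cong suc (s≡∥supp∥ x)

  -- Level counts, generating polynomials and equidistribution.

  level : {P : Pred X p} (f : X → ℕ) → Enumeration P → ∀ k → Enumeration (λ x → P x × f x ≡ k)
  level f E k = filterᴱ (λ x → f x ≟ k) E

  ∣∣≡sum-levels : {P : Pred X p} (f : X → ℕ) (E : Enumeration P) → ∀ N → (∀ x → f x ≤ N) →
    ∣ E ∣ ≡ sum (List.map (λ k → ∣ level f E k ∣) (≤ᴱ N .elements))
  ∣∣≡sum-levels f E N f≤N = trans
    (∣∣-bijection E (Σᴱ (level f E) (≤ᴱ N)) proj₂ (λ (_ , px , _) → px)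
      (λ where (_ , _ , refl) (_ , _ , refl) refl → refl)
      (λ {x} px → (f x , x) , (f≤N x , px , refl) , refl))
    (∣Σᴱ∣ (level f E) (≤ᴱ N))

  coeff-+ₚ : ∀ f g k → coeff (f +ₚ g) k ≡ coeff f k + coeff g k
  coeff-+ₚ [] g k = refl
  coeff-+ₚ (a ∷ f) [] k = sym (+-identityʳ _)
  coeff-+ₚ (a ∷ f) (b ∷ g) zero = refl
  coeff-+ₚ (a ∷ f) (b ∷ g) (suc k) = coeff-+ₚ f g k

  coeff-u^-≡ : ∀ k → coeff (u^ k) k ≡ 1
  coeff-u^-≡ zero = refl
  coeff-u^-≡ (suc k) = coeff-u^-≡ k

  coeff-u^-≢ : ∀ j k → j ≢ k → coeff (u^ j) k ≡ 0
  coeff-u^-≢ zero zero j≢k = contradiction refl j≢k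
  coeff-u^-≢ zero (suc k) j≢k = refl
  coeff-u^-≢ (suc j) zero j≢k = refl
  coeff-u^-≢ (suc j) (suc k) j≢k = coeff-u^-≢ j k (j≢k ∘ cong suc)

  coeff-Σu^ : {P : Pred X p} (f : X → ℕ) (E : Enumeration P) → ∀ k → coeff (Σu^ f E) k ≡ ∣ level f E k ∣
  coeff-Σu^ f E k = go (E .elements)
    where
    k? : Decidable (λ x → f x ≡ k)
    k? x = f x ≟ k
    go : ∀ xs → coeff (foldr _+ₚ_ [] (List.map (λ x → u^ (f x)) xs)) k ≡ length (filter k? xs)
    go [] = refl
    go (x ∷ xs) = trans (coeff-+ₚ (u^ (f x)) _ k) (head (k? x))
      where
      head : Dec (f x ≡ k) → _ ≡ length (filter k? (x ∷ xs))
      head (yes f≡k) = trans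
        (cong₂ _+_ (trans (cong (λ j → coeff (u^ j) k) f≡k) (coeff-u^-≡ k)) (go xs))
        (cong length (sym (filter-accept k? f≡k)))
      head (no f≢k) = trans
        (cong₂ _+_ (coeff-u^-≢ (f x) k f≢k) (go xs))
        (cong length (sym (filter-reject k? f≢k)))

  module _ (H : Family m n) (k : ℕ) where

    hallLevelᴱ : Enumeration (λ (d : Vec ℕ n) → Hall (cover H ⊤) d × ∥ supp d ∥ ≡ k)
    hallLevelᴱ = boundedᴱ (λ d → Hall? (cover H ⊤) d ×-dec (∥ supp d ∥ ≟ k)) m
      λ {d} (h , _) → lookup≤ d m λ S → ≤-trans (h S) (≤-trans (cover≤∥∥ H ⊤ S) (∣p∣≤n ⊤))

    sizedᴱ : Enumeration (λ (A : Subset n) → ∥ A ∥ ≡ k)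
    sizedᴱ = subsetᴱ λ A → ∥ A ∥ ≟ k

    matchedᴱ : Enumeration (λ ((A , T) : Subset n × Subset m) → ∥ A ∥ ≡ k × TransversalHall H A T)
    matchedᴱ = Σᴱ (transversalHallᴱ H) sizedᴱ

    ∣hallLevel∣≡∣matched∣ : ∣ hallLevelᴱ ∣ ≡ ∣ matchedᴱ ∣
    ∣hallLevel∣≡∣matched∣ = begin
      ∣ hallLevelᴱ ∣ ≡⟨ ∣∣-bijection hallLevelᴱ (Σᴱ (demandHallᴱ H) sizedᴱ) proj₂
                          (λ where (refl , refl , h) → h , refl)
                          (λ where (_ , refl , _) (_ , refl , _) refl → refl)
                          (λ {d} (h , eq) → (supp d , d) , (eq , refl , h) , refl) ⟩
      ∣ Σᴱ (demandHallᴱ H) sizedᴱ ∣ ≡⟨ ∣Σᴱ∣ (demandHallᴱ H) sizedᴱ ⟩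
      sum (List.map (λ A → ∣ demandHallᴱ H A ∣) (sizedᴱ .elements))
        ≡⟨ sum-cong (sizedᴱ .elements) (λ {A} _ → ∣demand∣≡∣transversal∣ H A) ⟩
      sum (List.map (λ A → ∣ transversalHallᴱ H A ∣) (sizedᴱ .elements)) ≡⟨ ∣Σᴱ∣ (transversalHallᴱ H) sizedᴱ ⟨
      ∣ matchedᴱ ∣ ∎
      where open ≡-Reasoning

    -- The number of sign choices is constant on a level, so it factors out and leaves the quantity
    -- that is symmetric in the two sides.
    ∣latticeLevel∣ : {P : Pred (Vec ℤ n) p} (E : Enumeration P) →
      (∀ {x} → P x → LatticeHall H x) → (∀ {x} → LatticeHall H x → P x) →
      ∣ level s E k ∣ ≡ ∣ matchedᴱ ∣ * 2 ^ k
    ∣latticeLevel∣ E P⇒ ⇒P = begin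
      ∣ level s E k ∣ ≡⟨ ∣∣-bijection (level s E k) (Σᴱ absⱽᴱ hallLevelᴱ) proj₂
                            (λ {y} → to (proj₁ y) (proj₂ y))
                            (λ where (_ , refl) (_ , refl) refl → refl)
                            (λ {x} (px , eq) → (∣ x ∣ⱽ , x) , ((P⇒ px , trans (sym (s≡∥supp∥ x)) eq) , refl) , refl) ⟩
      ∣ Σᴱ absⱽᴱ hallLevelᴱ ∣ ≡⟨ ∣Σᴱ∣ absⱽᴱ hallLevelᴱ ⟩
      sum (List.map (λ d → ∣ absⱽᴱ d ∣) (hallLevelᴱ .elements))
        ≡⟨ sum-const (hallLevelᴱ .elements) (λ {d} d∈ →
             trans (∣absⱽᴱ∣ d) (cong (2 ^_) (proj₂ (All.lookup (hallLevelᴱ .sound) d∈)))) ⟩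
      ∣ hallLevelᴱ ∣ * 2 ^ k ≡⟨ cong (_* 2 ^ k) ∣hallLevel∣≡∣matched∣ ⟩
      ∣ matchedᴱ ∣ * 2 ^ k ∎
      where
      open ≡-Reasoning
      to : ∀ d x → (Hall (cover H ⊤) d × ∥ supp d ∥ ≡ k) × ∣ x ∣ⱽ ≡ d → _ × s x ≡ k
      to _ x ((h , eq) , refl) = ⇒P h , trans (s≡∥supp∥ x) eq

  ∣matched∣-swap : ∀ (G : BipartiteGraph m n) k → ∣ matchedᴱ (family G) k ∣ ≡ ∣ matchedᴱ (family (swap G)) k ∣
  ∣matched∣-swap G k = ∣∣-bijection (matchedᴱ (family G) k) (matchedᴱ (family (swap G)) k) ×.swap
    (λ (eq , h@(eq′ , _)) → trans eq′ eq , transversalHall-sym (family (swap G)) (family G) (family-swap (swap G)) h)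
    (λ where _ _ refl → refl)
    (λ where (eq , h@(eq′ , _)) → _ ,
               (trans eq′ eq , transversalHall-sym (family G) (family (swap G)) (family-swap G) h) , refl)

  equidistribution : ∀ (G : BipartiteGraph m n) {P : Pred (Vec ℤ n) p} {Q : Pred (Vec ℤ m) q}
    (E : Enumeration P) (F : Enumeration Q) →
    (∀ x → P x → LatticeHall (family G) x) → (∀ x → LatticeHall (family G) x → P x) →
    (∀ y → Q y → LatticeHall (family (swap G)) y) → (∀ y → LatticeHall (family (swap G)) y → Q y) →
    ∣ E ∣ ≡ ∣ F ∣ × Σu^ s E ≈ₚ Σu^ s F
  equidistribution {m} {n} G E F P⇒ ⇒P Q⇒ ⇒Q = total , λ k →
    trans (coeff-Σu^ s E k) (trans (levels k) (sym (coeff-Σu^ s F k)))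
    where
    levels : ∀ k → ∣ level s E k ∣ ≡ ∣ level s F k ∣
    levels k = begin
      ∣ level s E k ∣                          ≡⟨ ∣latticeLevel∣ (family G) k E (P⇒ _) (⇒P _) ⟩
      ∣ matchedᴱ (family G) k ∣ * 2 ^ k        ≡⟨ cong (_* 2 ^ k) (∣matched∣-swap G k) ⟩
      ∣ matchedᴱ (family (swap G)) k ∣ * 2 ^ k ≡⟨ ∣latticeLevel∣ (family (swap G)) k F (Q⇒ _) (⇒Q _) ⟨
      ∣ level s F k ∣                          ∎
      where open ≡-Reasoning
    total : ∣ E ∣ ≡ ∣ F ∣
    total = begin
      -- `m + n` bounds `s` for points of either dimension, so both totals are sums over the same
      -- list of levels.
      ∣ E ∣ ≡⟨ ∣∣≡sum-levels s E (m + n) (λ x → ≤-trans (count≤n _ x) (m≤n+m n m)) ⟩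
      sum (List.map (λ k → ∣ level s E k ∣) (≤ᴱ (m + n) .elements))
        ≡⟨ sum-cong (≤ᴱ (m + n) .elements) (λ {k} _ → levels k) ⟩
      sum (List.map (λ k → ∣ level s F k ∣) (≤ᴱ (m + n) .elements))
        ≡⟨ ∣∣≡sum-levels s F (m + n) (λ y → ≤-trans (count≤n _ y) (m≤m+n m n)) ⟨
      ∣ F ∣ ∎
      where open ≡-Reasoning

module Geometry {c ℓ₁ ℓ₂ ℓ₃} (K : OrderedField c ℓ₁ ℓ₂ ℓ₃) where

  open Combinatorics
  open import Algebra.Bundles using (CommutativeRing)
  import Algebra.Properties.CommutativeMonoid.Sum
  import Algebra.Properties.Monoid.Mult
  import Algebra.Properties.Ring
  import Algebra.Properties.Semiring.Sum
  open import Algebra.Apartness.Bundles using (HeytingField)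
  import Algebra.Apartness.Properties.HeytingCommutativeRing
  open import Data.Bool.Base using (true; false; if_then_else_)
  open import Data.Fin.Base using (Fin; zero; suc)
  open import Data.Fin.Properties using (∀-cons) renaming (_≟_ to _≟ᶠ_)
  open import Data.Fin.Subset as Subset using (Subset; ⊤; _∈_)
  open import Data.Fin.Subset.Properties using (nonempty?)
  open import Data.Integer.Base as ℤ using (ℤ; -[1+_]; 0ℤ)
  import Data.Integer.Properties as ℤ
  open import Data.Nat.Base as ℕ using (ℕ; zero; suc; pred; s≤s⁻¹)
  import Data.Nat.Properties as ℕ
  open import Data.Product.Base using (∃-syntax; _×_; _,_)
  open import Data.Sum.Base using (_⊎_; inj₁; inj₂; [_,_]′)
  open import Data.Vec.Base as Vec using (Vec; []; _∷_; lookup; here; there)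
  open import Data.Vec.Functional using () renaming (_∷_ to _∷ᶠ_)
  open import Data.Vec.Properties
    using (lookup-map; lookup∘updateAt; lookup∘updateAt′; map-updateAt; lookup⇒[]=)
  open import Function.Base using (_∘_; case_of_)
  open import Relation.Binary.PropositionalEquality as ≡ using (_≡_)
  open import Relation.Binary.Structures using (IsStrictPartialOrder)
  import Relation.Binary.Reasoning.Setoid
  open import Relation.Nullary.Decidable using (yes; no; dec-true; dec-false)
  open import Relation.Nullary.Negation using (contradiction)

  open MinTight

  open OrderedField K
    using (heytingField; commutativeRing; _<_; _≤_; isStrictPartialOrder; #⇒<⊎>; <⇒#; +-monoˡ-<; *-pos)
  open HeytingField heytingField using (#-cotrans; #⇒invertible; heytingCommutativeRing)
  open CommutativeRing commutativeRing hiding (zero)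
  open Polytopes K hiding (sum; _⋆_)
  open IsStrictPartialOrder isStrictPartialOrder
    using (irrefl; asym; <-respʳ-≈; <-respˡ-≈) renaming (trans to <-trans)
  open Algebra.Apartness.Properties.HeytingCommutativeRing heytingCommutativeRing using (1#0; x-0≈x)
  open Algebra.Properties.Ring ring
  open Algebra.Properties.CommutativeMonoid.Sum +-commutativeMonoid using (sum; sum-cong-≋; ∑-comm)
  open Algebra.Properties.Semiring.Sum semiring using (*-distribˡ-sum; *-distribʳ-sum)
  open Algebra.Properties.Monoid.Mult +-monoid using (×-homo-+; ×-homo-1) renaming (_×_ to _⋆_)
  open Relation.Binary.Reasoning.Setoid setoid

  private variable
    m n : ℕ

  -- Arithmetic of the constructive order.

  <-resp : ∀ {x x′ y y′} → x ≈ x′ → y ≈ y′ → x < y → x′ < y′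
  <-resp p q = <-respˡ-≈ p ∘ <-respʳ-≈ q

  ≤-resp : ∀ {x x′ y y′} → x ≈ x′ → y ≈ y′ → x ≤ y → x′ ≤ y′
  ≤-resp p q x≤y y′<x′ = x≤y (<-resp (sym q) (sym p) y′<x′)

  ≤-reflexive : ∀ {x y} → x ≈ y → x ≤ y
  ≤-reflexive x≈y = irrefl (sym x≈y)

  <⇒≤ : ∀ {x y} → x < y → x ≤ y
  <⇒≤ x<y = asym x<y

  -- Takes the place of trichotomy in the order arguments below; it is cotransitivity of apartness
  -- with the wrong orientations resolved by transitivity.
  <-cotrans : ∀ {x y} → x < y → ∀ z → x < z ⊎ z < y
  <-cotrans {x} {y} x<y z with #-cotrans (<⇒# x<y) z
  ... | inj₁ x#z = [ inj₁ , (λ z<x → inj₂ (<-trans z<x x<y)) ]′ (#⇒<⊎> x#z)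
  ... | inj₂ z#y = [ inj₂ , (λ y<z → inj₁ (<-trans x<y y<z)) ]′ (#⇒<⊎> z#y)

  +-monoʳ-< : ∀ z {x y} → x < y → z + x < z + y
  +-monoʳ-< z {x} {y} x<y = <-resp (+-comm x z) (+-comm y z) (+-monoˡ-< z x<y)

  +-cancelʳ-< : ∀ z {x y} → x + z < y + z → x < y
  +-cancelʳ-< z {x} {y} lt = <-resp (lem x) (lem y) (+-monoˡ-< (- z) lt)
    where
    lem : ∀ x → (x + z) + - z ≈ x
    lem x = trans (+-assoc x z (- z)) (trans (+-congˡ (-‿inverseʳ z)) (+-identityʳ x))

  +-cancelˡ-< : ∀ z {x y} → z + x < z + y → x < y
  +-cancelˡ-< z {x} {y} lt = +-cancelʳ-< z (<-resp (+-comm z x) (+-comm z y) lt)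

  -- As `≤` is a negation, a violation `b + d < a + c` is refuted by comparing with the intermediate
  -- value `a + d`.
  +-mono-≤ : ∀ {a b c d} → a ≤ b → c ≤ d → a + c ≤ b + d
  +-mono-≤ {a} {b} {c} {d} a≤b c≤d lt with <-cotrans lt (a + d)
  ... | inj₁ lt₁ = a≤b (+-cancelʳ-< d lt₁)
  ... | inj₂ lt₂ = c≤d (+-cancelˡ-< a lt₂)

  neg-pos : ∀ {x} → x < 0# → 0# < - x
  neg-pos {x} x<0 = <-resp (-‿inverseʳ x) (+-identityˡ (- x)) (+-monoˡ-< (- x) x<0)

  0<1 : 0# < 1#
  0<1 with #⇒<⊎> 1#0
  ... | inj₂ 0<1 = 0<1
  -- If `1# < 0#`, then `- 1#` is positive and so is its square, which is `1#`.
  ... | inj₁ 1<0 = <-respʳ-≈ (trans (-1*x≈-x (- 1#)) (-‿involutive 1#)) (*-pos (neg-pos 1<0) (neg-pos 1<0))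

  sum-mono : ∀ {r} (f g : Fin r → Carrier) → (∀ i → f i ≤ g i) → sum f ≤ sum g
  sum-mono {zero} f g f≤g = ≤-reflexive refl
  sum-mono {suc r} f g f≤g = +-mono-≤ (f≤g zero) (sum-mono (f ∘ suc) (g ∘ suc) (f≤g ∘ suc))

  0≤⋆ : ∀ k → 0# ≤ k ⋆ 1#
  0≤⋆ zero    = ≤-reflexive refl
  0≤⋆ (suc k) = ≤-resp (+-identityˡ 0#) refl (+-mono-≤ (<⇒≤ 0<1) (0≤⋆ k))

  ⋆-mono-< : ∀ {j k} → j ℕ.< k → j ⋆ 1# < k ⋆ 1#
  ⋆-mono-< {zero} {suc k} _ with <-cotrans 0<1 (1# + k ⋆ 1#)
  ... | inj₁ lt = lt
  ... | inj₂ lt = contradiction (<-resp refl (sym (+-identityʳ 1#)) lt)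
                    (+-mono-≤ (≤-reflexive refl) (0≤⋆ k))
  ⋆-mono-< {suc j} {suc k} lt = +-monoʳ-< 1# (⋆-mono-< (s≤s⁻¹ lt))

  0≤x⇒-x≤x : ∀ {x} → 0# ≤ x → - x ≤ x
  0≤x⇒-x≤x {x} 0≤x x<-x with <-cotrans x<-x 0#
  ... | inj₁ x<0 = 0≤x x<0
  ... | inj₂ 0<-x = 0≤x (<-resp (+-identityʳ x) (-‿inverseʳ x) (+-monoʳ-< x 0<-x))

  -- From the polytope to Hall's condition by linear functionals.

  ⟨_,_⟩ : (Fin n → Carrier) → Point n → Carrier
  ⟨ a , p ⟩ = sum λ i → a i * p i

  ⟨⟩-cong : ∀ (a : Fin n → Carrier) {p q} → p ≋ q → ⟨ a , p ⟩ ≈ ⟨ a , q ⟩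
  ⟨⟩-cong a p≋q = sum-cong-≋ λ i → *-congˡ (p≋q i)

  ⟨⟩-sum : ∀ {r} (a : Fin n → Carrier) (p : Fin r → Point n) →
    ⟨ a , (λ i → sum λ t → p t i) ⟩ ≈ sum λ t → ⟨ a , p t ⟩
  ⟨⟩-sum a p = trans (sum-cong-≋ λ i → *-distribˡ-sum (a i) (λ t → p t i)) (∑-comm (λ i t → a i * p t i))

  ⟨⟩-scale : ∀ (a : Fin n → Carrier) w (p : Point n) → ⟨ a , (λ i → w * p i) ⟩ ≈ w * ⟨ a , p ⟩
  ⟨⟩-scale a w p = trans
    (sum-cong-≋ λ i → trans (sym (*-assoc (a i) w (p i))) (trans (*-congʳ (*-comm (a i) w)) (*-assoc w (a i) (p i))))
    (sym (*-distribˡ-sum w (λ i → a i * p i)))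

  sum-≈0 : ∀ {r} (f : Fin r → Carrier) → (∀ i → f i ≈ 0#) → sum f ≈ 0#
  sum-≈0 {zero} f _ = refl
  sum-≈0 {suc r} f f≈0 = trans (+-cong (f≈0 zero) (sum-≈0 (f ∘ suc) (f≈0 ∘ suc))) (+-identityˡ 0#)

  ⟨⟩-e : ∀ (a : Fin n → Carrier) i → ⟨ a , e i ⟩ ≈ a i
  ⟨⟩-e a zero = trans (+-cong (*-identityʳ (a zero)) (sum-≈0 _ λ i → zeroʳ (a (suc i)))) (+-identityʳ (a zero))
  ⟨⟩-e a (suc i) = trans (+-cong (zeroʳ (a zero)) (⟨⟩-e (a ∘ suc) i)) (+-identityˡ (a (suc i)))

  ⟨⟩--e : ∀ (a : Fin n → Carrier) i → ⟨ a , -e i ⟩ ≈ - a i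
  ⟨⟩--e a i = begin
    ⟨ a , -e i ⟩                   ≈⟨ ⟨⟩-cong a (λ k → -1*x≈-x (e i k)) ⟨
    ⟨ a , (λ k → - 1# * e i k) ⟩   ≈⟨ ⟨⟩-scale a (- 1#) (e i) ⟩
    - 1# * ⟨ a , e i ⟩             ≈⟨ *-congˡ (⟨⟩-e a i) ⟩
    - 1# * a i                     ≈⟨ -1*x≈-x (a i) ⟩
    - a i                          ∎

  -- A zero coordinate in `S` receives the sign `1#`; it contributes nothing to the pairing with
  -- `x`.
  signs : Subset n → Vec ℤ n → Fin n → Carrier
  signs S x i = if lookup S i then sign (lookup x i) else 0#
    where
    sign : ℤ → Carrier
    sign (ℤ.+ _)  = 1#
    sign -[1+ _ ] = - 1#

  lattice : Vec ℤ n → Point n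
  lattice x i = fromℤ (lookup x i)

  ⟨signs⟩ : ∀ (S : Subset n) (x : Vec ℤ n) → ⟨ signs S x , lattice x ⟩ ≈ weight ∣ x ∣ⱽ S ⋆ 1#
  ⟨signs⟩ [] [] = refl
  ⟨signs⟩ (false ∷ S) (z ∷ x) = trans (+-cong (zeroˡ (fromℤ z)) (⟨signs⟩ S x)) (+-identityˡ _)
  ⟨signs⟩ (true ∷ S) (z ∷ x) = trans (+-cong (lem z) (⟨signs⟩ S x)) (sym (×-homo-+ 1# ℤ.∣ z ∣ (weight ∣ x ∣ⱽ S)))
    where
    lem : ∀ z → signs (true ∷ S) (z ∷ x) zero * fromℤ z ≈ ℤ.∣ z ∣ ⋆ 1#
    lem (ℤ.+ k)  = *-identityˡ _
    lem -[1+ k ] = trans (-1*x≈-x _) (-‿involutive _)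

  signs-values : ∀ (S : Subset n) (x : Vec ℤ n) i →
    signs S x i ≈ 0# ⊎ i ∈ S × (signs S x i ≈ 1# ⊎ signs S x i ≈ - 1#)
  signs-values S x i with lookup S i in eq | lookup x i
  ... | false | _         = inj₁ refl
  ... | true  | ℤ.+ _     = inj₂ (lookup⇒[]= i S eq , inj₁ refl)
  ... | true  | -[1+ _ ]  = inj₂ (lookup⇒[]= i S eq , inj₂ refl)

  module _ (S : Subset n) (x : Vec ℤ n) (I : Subset n) where

    private
      a = signs S x
      β = ⟦ meets I S ⟧ ⋆ 1#

      -- The comparison keeps the convex weight `w` as a factor: `y` is `0#`, `1#` or `- 1#`, so
      -- each case follows from `0# ≤ w` directly.
      scaled≤ : ∀ {w i y} → 0# ≤ w → i ∈ I → y ≈ a i ⊎ y ≈ - a i → w * y ≤ w * β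
      scaled≤ {w} {i} {y} 0≤w i∈I y≈ with signs-values S x i
      ... | inj₁ aᵢ≈0 = ≤-resp (sym (trans (*-congˡ y≈0) (zeroʳ w))) refl 0≤wβ
        where
        y≈0 : y ≈ 0#
        y≈0 = [ (λ p → trans p aᵢ≈0) , (λ p → trans p (trans (-‿cong aᵢ≈0) -0#≈0#)) ]′ y≈
        0≤wβ : 0# ≤ w * β
        0≤wβ with meets I S
        ... | true  = ≤-resp refl (sym (trans (*-congˡ (+-identityʳ 1#)) (*-identityʳ w))) 0≤w
        ... | false = ≤-reflexive (sym (zeroʳ w))
      ... | inj₂ (i∈S , aᵢ≈±1) rewrite meets⁺ I S i∈I i∈S =
        ≤-resp refl (sym (*-congˡ (+-identityʳ 1#))) (≤-resp refl (sym (*-identityʳ w)) wy≤w)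
        where
        y≈±1 : y ≈ a i ⊎ y ≈ - a i → a i ≈ 1# ⊎ a i ≈ - 1# → y ≈ 1# ⊎ y ≈ - 1#
        y≈±1 (inj₁ p) (inj₁ q) = inj₁ (trans p q)
        y≈±1 (inj₁ p) (inj₂ q) = inj₂ (trans p q)
        y≈±1 (inj₂ p) (inj₁ q) = inj₂ (trans p (-‿cong q))
        y≈±1 (inj₂ p) (inj₂ q) = inj₁ (trans p (trans (-‿cong q) (-‿involutive 1#)))
        wy≤w : w * y ≤ w
        wy≤w with y≈±1 y≈ aᵢ≈±1
        ... | inj₁ y≈1  = ≤-reflexive (trans (*-congˡ y≈1) (*-identityʳ w))
        ... | inj₂ y≈-1 = ≤-resp (sym (trans (*-congˡ y≈-1) (trans (sym (-‿distribʳ-* w 1#)) (-‿cong (*-identityʳ w)))))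
                                 refl (0≤x⇒-x≤x 0≤w)

      vertex : ∀ {v} → ±e I v → ∃[ i ] i ∈ I × (⟨ a , v ⟩ ≈ a i ⊎ ⟨ a , v ⟩ ≈ - a i)
      vertex (i , i∈I , inj₁ v≋) = i , i∈I , inj₁ (trans (⟨⟩-cong a v≋) (⟨⟩-e a i))
      vertex (i , i∈I , inj₂ v≋) = i , i∈I , inj₂ (trans (⟨⟩-cong a v≋) (⟨⟩--e a i))

    -- At a vertex the functional is plus or minus one entry `a i` with `i ∈ I`, which vanishes
    -- unless `i ∈ S`, and then `I` meets `S`. Averaging with weights of sum one preserves the
    -- bound.
    ⟨signs⟩-◇ : ∀ {p} → ◇ I p → ⟨ a , p ⟩ ≤ β
    ⟨signs⟩-◇ (inj₂ (_ , p≋0)) = ≤-resp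
      (sym (trans (⟨⟩-cong a p≋0) (sum-≈0 _ λ i → zeroʳ (a i)))) refl (0≤⋆ ⟦ meets I S ⟧)
    ⟨signs⟩-◇ {p} (inj₁ (_ , r , v , w , v∈ , 0≤w , ∑w≈1 , p≋)) = ≤-resp (sym lhs) rhs
      (sum-mono _ _ λ t → let i , i∈I , y≈ = vertex (v∈ t) in scaled≤ (0≤w t) i∈I y≈)
      where
      lhs : ⟨ a , p ⟩ ≈ sum λ t → w t * ⟨ a , v t ⟩
      lhs = begin
        ⟨ a , p ⟩                             ≈⟨ ⟨⟩-cong a p≋ ⟩
        ⟨ a , (λ i → sum λ t → w t * v t i) ⟩ ≈⟨ ⟨⟩-sum a (λ t i → w t * v t i) ⟩
        sum (λ t → ⟨ a , (λ i → w t * v t i) ⟩) ≈⟨ sum-cong-≋ (λ t → ⟨⟩-scale a (w t) (v t)) ⟩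
        sum (λ t → w t * ⟨ a , v t ⟩)         ∎
      rhs : sum (λ t → w t * β) ≈ β
      rhs = begin
        sum (λ t → w t * β) ≈⟨ *-distribʳ-sum β w ⟨
        sum w * β           ≈⟨ *-congʳ ∑w≈1 ⟩
        1# * β              ≈⟨ *-identityˡ β ⟩
        β                   ∎

  sum-meets : ∀ (I : Fin m → Subset n) S → sum (λ j → ⟦ meets (I j) S ⟧ ⋆ 1#) ≈ cover (Vec.tabulate I) ⊤ S ⋆ 1#
  sum-meets {zero} I S = refl
  sum-meets {suc m} I S = trans (+-congˡ (sum-meets (I ∘ suc) S))
    (sym (×-homo-+ 1# ⟦ meets (I zero) S ⟧ (cover (Vec.tabulate (I ∘ suc)) ⊤ S)))

  -- The inequality is obtained in the field between multiples of `1#`; strict monotonicity of these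
  -- multiples brings it back to natural numbers.
  Q⇒LatticeHall : ∀ (G : BipartiteGraph m n) x → (Q G ∩ℤ) x → LatticeHall (family G) x
  Q⇒LatticeHall G x (b , b∈ , x≋) S = ℕ.≮⇒≥ λ lt → pairing≤ (⋆-mono-< lt)
    where
    a = signs S x
    b≤ : ∀ j → ⟨ a , b j ⟩ ≤ ⟦ meets (I[ G ] j) S ⟧ ⋆ 1#
    b≤ j with b∈ j
    ... | p , p∈◇ , bⱼ≋ = ≤-resp (sym (⟨⟩-cong a λ i → trans (bⱼ≋ i) (×-homo-1 (p i)))) refl
                            (⟨signs⟩-◇ S x (I[ G ] j) p∈◇)
    pairing≤ : weight ∣ x ∣ⱽ S ⋆ 1# ≤ cover (family G) ⊤ S ⋆ 1#
    pairing≤ = ≤-resp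
      (trans (sym (⟨⟩-sum a b)) (trans (sym (⟨⟩-cong a x≋)) (⟨signs⟩ S x)))
      (sum-meets I[ G ] S)
      (sum-mono _ _ b≤)

  -- From Hall's condition to the polytope by peeling off summands.

  ½ : ∃[ h ] h + h ≈ 1# × 0# ≤ h
  ½ with #⇒invertible (OrderedField.#-sym K (<⇒# 0<2))
    where
    0<2 : 0# < 1# + 1#
    0<2 = <-trans 0<1 (<-resp (+-identityʳ 1#) refl (+-monoʳ-< 1# 0<1))
  ... | h , h*2≈1 , _ = h , h+h≈1 , λ h<0 → asym 0<1
          (<-resp h+h≈1 refl (<-trans (+-monoˡ-< h h<0) (<-resp (sym (+-identityˡ h)) refl h<0)))
    where
    h+h≈1 : h + h ≈ 1#
    h+h≈1 = begin
      h + h                 ≈⟨ +-cong (*-identityʳ h) (*-identityʳ h) ⟨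
      h * 1# + h * 1#       ≈⟨ distribˡ h 1# 1# ⟨
      h * (1# + 1#)         ≈⟨ *-congˡ (x-0≈x (1# + 1#)) ⟨
      -- Apartness of two elements inverts their difference, here that of two and zero.
      h * ((1# + 1#) - 0#)  ≈⟨ h*2≈1 ⟩
      1#                    ∎

  -- For nonempty `I` the origin is the midpoint of `e i` and `-e i`, which is what `½` is for.
  𝟎∈◇ : ∀ (I : Subset n) → ◇ I 𝟎
  𝟎∈◇ I with nonempty? I
  ... | no empty = inj₂ (empty , λ _ → refl)
  ... | yes (i , i∈I) with h , h+h≈1 , 0≤h ← ½ = inj₁ ((i , i∈I) , 2 , v , (λ _ → h) , v∈
          , (λ _ → 0≤h) , trans (+-congˡ (+-identityʳ h)) h+h≈1 , λ k → sym (cancel k))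
    where
    v : Fin 2 → Point _
    v zero       = e i
    v (suc zero) = -e i
    v∈ : ∀ t → ±e I (v t)
    v∈ zero       = i , i∈I , inj₁ λ _ → refl
    v∈ (suc zero) = i , i∈I , inj₂ λ _ → refl
    cancel : ∀ k → h * e i k + (h * - e i k + 0#) ≈ 0#
    cancel k = begin
      h * e i k + (h * - e i k + 0#) ≈⟨ +-congˡ (+-identityʳ _) ⟩
      h * e i k + h * - e i k        ≈⟨ distribˡ h (e i k) (- e i k) ⟨
      h * (e i k + - e i k)          ≈⟨ *-congˡ (-‿inverseʳ (e i k)) ⟩
      h * 0#                         ≈⟨ zeroʳ h ⟩
      0#                             ∎

  ±e⊆◇ : ∀ {I : Subset n} {v} → ±e I v → ◇ I v
  ±e⊆◇ {v = v} v∈@(i , i∈I , _) = inj₁ ((i , i∈I) , 1 , (λ _ → v) , (λ _ → 1#) , (λ _ → v∈)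
    , (λ _ → <⇒≤ 0<1) , +-identityʳ 1# , λ k → sym (trans (+-identityʳ _) (*-identityˡ (v k))))

  ⊆dilate-1 : ∀ {ℓ} {A : Point n → Set ℓ} {p} → A p → dilate 1 A p
  ⊆dilate-1 {p = p} p∈A = p , p∈A , λ i → sym (×-homo-1 (p i))

  towardZero : ℤ → ℤ
  towardZero (ℤ.+ k)      = ℤ.+ pred k
  towardZero -[1+ zero ]  = 0ℤ
  towardZero -[1+ suc k ] = -[1+ k ]

  ∣towardZero∣ : ∀ z → ℤ.∣ towardZero z ∣ ≡ pred ℤ.∣ z ∣
  ∣towardZero∣ (ℤ.+ _)      = ≡.refl
  ∣towardZero∣ -[1+ zero ]  = ≡.refl
  ∣towardZero∣ -[1+ suc _ ] = ≡.refl

  weight-pred-≤ : ∀ (d : Vec ℕ n) i S → weight (Vec.updateAt d i pred) S ℕ.≤ weight d S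
  weight-pred-≤ (a ∷ d) zero (true ∷ S) = ℕ.+-monoˡ-≤ (weight d S) ℕ.pred[n]≤n
  weight-pred-≤ (a ∷ d) zero (false ∷ S) = ℕ.≤-refl
  weight-pred-≤ (a ∷ d) (suc i) (true ∷ S) = ℕ.+-monoʳ-≤ a (weight-pred-≤ d i S)
  weight-pred-≤ (a ∷ d) (suc i) (false ∷ S) = weight-pred-≤ d i S

  weight-pred : ∀ (d : Vec ℕ n) {i S} → 0 ℕ.< lookup d i → i ∈ S →
    suc (weight (Vec.updateAt d i pred) S) ≡ weight d S
  weight-pred (suc a ∷ d) {zero} _ here = ≡.refl
  weight-pred (a ∷ d) {suc i} {true ∷ S} 0<d (there i∈S) =
    ≡.trans (≡.sym (ℕ.+-suc a _)) (≡.cong (a ℕ.+_) (weight-pred d 0<d i∈S))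
  weight-pred (a ∷ d) {suc i} {false ∷ S} 0<d (there i∈S) = weight-pred d 0<d i∈S

  -- Every tight set contains `R` and hence `i`, so it loses its one unit of excess; the other sets
  -- had none.
  hall-pred : ∀ {ρ : Subset n → ℕ} {d R i} → Polymatroid ρ → MinTight ρ d R → i ∈ R →
    Hall ρ (Vec.updateAt d i pred)
  hall-pred {ρ = ρ} {d} {R} {i} P p i∈R S with ℕ.m≤n⇒m<n∨m≡n (p .bound S)
  ... | inj₁ lt = ℕ.≤-trans (weight-pred-≤ d i S) (s≤s⁻¹ lt)
  ... | inj₂ eq = ℕ.≤-reflexive (ℕ.suc-injective
                    (≡.trans (weight-pred d (minTight⇒nonzero P p i∈R) (p .minimal eq i∈R)) eq))

  step : ∀ (I : Subset n) (x : Vec ℤ n) {i} → i ∈ I → 0 ℕ.< ℤ.∣ lookup x i ∣ →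
    ∃[ v ] ±e I v × ∀ k → lattice x k ≈ v k + lattice (Vec.updateAt x i towardZero) k
  step I x {i} i∈I x≢0 with lookup x i in eq
  ... | ℤ.+ suc a = e i , (i , i∈I , inj₁ λ _ → refl) , λ k → case i ≟ᶠ k of λ where
      (yes ≡.refl) → begin
        fromℤ (lookup x i) ≡⟨ ≡.cong fromℤ eq ⟩
        1# + a ⋆ 1# ≡⟨ ≡.cong₂ (λ b z → (if b then 1# else 0#) + fromℤ z) (dec-true (i ≟ᶠ i) ≡.refl)
                        (≡.trans (lookup∘updateAt i x) (≡.cong towardZero eq)) ⟨
        e i i + lattice (Vec.updateAt x i towardZero) i ∎
      (no i≢k) → begin
        fromℤ (lookup x k) ≈⟨ +-identityˡ _ ⟨
        0# + fromℤ (lookup x k) ≡⟨ ≡.cong₂ (λ b z → (if b then 1# else 0#) + fromℤ z) (dec-false (i ≟ᶠ k) i≢k)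
                        (lookup∘updateAt′ k i (i≢k ∘ ≡.sym) x) ⟨
        e i k + lattice (Vec.updateAt x i towardZero) k ∎
  ... | -[1+ a ] = -e i , (i , i∈I , inj₂ λ _ → refl) , λ k → case i ≟ᶠ k of λ where
      (yes ≡.refl) → begin
        fromℤ (lookup x i) ≡⟨ ≡.cong fromℤ eq ⟩
        - (1# + a ⋆ 1#) ≈⟨ lem a ⟩
        - 1# + fromℤ (towardZero -[1+ a ])
          ≡⟨ ≡.cong₂ (λ b z → - (if b then 1# else 0#) + fromℤ z) (dec-true (i ≟ᶠ i) ≡.refl)
                        (≡.trans (lookup∘updateAt i x) (≡.cong towardZero eq)) ⟨
        -e i i + lattice (Vec.updateAt x i towardZero) i ∎
      (no i≢k) → begin
        fromℤ (lookup x k) ≈⟨ +-identityˡ _ ⟨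
        0# + fromℤ (lookup x k) ≈⟨ +-congʳ -0#≈0# ⟨
        - 0# + fromℤ (lookup x k) ≡⟨ ≡.cong₂ (λ b z → - (if b then 1# else 0#) + fromℤ z) (dec-false (i ≟ᶠ k) i≢k)
                        (lookup∘updateAt′ k i (i≢k ∘ ≡.sym) x) ⟨
        -e i k + lattice (Vec.updateAt x i towardZero) k ∎
    where
    lem : ∀ a → - (1# + a ⋆ 1#) ≈ - 1# + fromℤ (towardZero -[1+ a ])
    lem zero    = trans (-‿cong (+-identityʳ 1#)) (sym (+-identityʳ (- 1#)))
    lem (suc a) = sym (-‿+-comm 1# (suc a ⋆ 1#))

  -- If the remaining left vertices suffice for `x`, the first one contributes the origin. Otherwise
  -- it meets the least tight set in some `i`, and it contributes the vertex `e i` or `-e i` that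
  -- brings coordinate `i` one step closer to zero.
  hall⇒minkowskiSum : ∀ (I : Fin m → Subset n) x → LatticeHall (Vec.tabulate I) x →
    minkowskiSum (λ j → dilate 1 (◇ (I j))) (lattice x)
  hall⇒minkowskiSum {m = zero} I x h = (λ ()) , (λ ()) , λ i →
    reflexive (≡.cong fromℤ (ℤ.∣i∣≡0⇒i≡0 {lookup x i} (ℕ.n≤0⇒n≡0
      (≡.subst (ℕ._≤ 0) (≡.trans (weight-⁅⁆ ∣ x ∣ⱽ i) (lookup-map i ℤ.∣_∣ x)) (h Subset.⁅ i ⁆)))))
  hall⇒minkowskiSum {m = suc m} {n} I x h with hall-insert⁻ P {∣ x ∣ⱽ} (I zero) h
    where P = cover-polymatroid (Vec.tabulate (I ∘ suc)) ⊤
  ... | inj₁ h′ with b , b∈ , x≋ ← hall⇒minkowskiSum (I ∘ suc) x h′ =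
    𝟎 ∷ᶠ b , ∀-cons (⊆dilate-1 (𝟎∈◇ (I zero))) b∈
    , λ i → trans (x≋ i) (sym (+-identityˡ _))
  ... | inj₂ (R , mt , p) with i , i∈I , i∈R ← meets⁻ (I zero) R mt
    with v , v∈ , x≋ ← step (I zero) x i∈I
      (≡.subst (0 ℕ.<_) (lookup-map i ℤ.∣_∣ x)
        (minTight⇒nonzero (cover-polymatroid (Vec.tabulate (I ∘ suc)) ⊤) p i∈R))
    with b , b∈ , x′≋ ← hall⇒minkowskiSum (I ∘ suc) (Vec.updateAt x i towardZero)
      (≡.subst (Hall (cover (Vec.tabulate (I ∘ suc)) ⊤)) (≡.sym (map-updateAt x i (∣towardZero∣ (lookup x i))))
        (hall-pred (cover-polymatroid (Vec.tabulate (I ∘ suc)) ⊤) p i∈R)) =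
    v ∷ᶠ b , ∀-cons (⊆dilate-1 (±e⊆◇ v∈)) b∈
    , λ k → trans (x≋ k) (+-congˡ (x′≋ k))

  LatticeHall⇒Q : ∀ (G : BipartiteGraph m n) x → LatticeHall (family G) x → (Q G ∩ℤ) x
  LatticeHall⇒Q G = hall⇒minkowskiSum I[ G ]

  -- Membership in the polytope is never decided over `K`; the list comes from the finite, decidable
  -- Hall condition.
  latticePointsᴱ : ∀ (G : BipartiteGraph m n) → Enumeration (Q G ∩ℤ)
  latticePointsᴱ G = respᴱ (λ {x} → LatticeHall⇒Q G x) (λ {x} → Q⇒LatticeHall G x) (latticeHallᴱ (family G))

corollary4p6 : ∀ {c ℓ₁ ℓ₂ ℓ₃} (K : OrderedField c ℓ₁ ℓ₂ ℓ₃) →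
    let open Polytopes K in
    ∀ (m n : ℕ) (G : BipartiteGraph m n) →
    Σ[ X ∈ Enumeration (Q G ∩ℤ) ]
    Σ[ Y ∈ Enumeration (Q (swap G) ∩ℤ) ]
    (∣ X ∣ ≡ ∣ Y ∣) × (Σu^ s X ≈ₚ Σu^ s Y)
corollary4p6 K m n G = latticePointsᴱ G , latticePointsᴱ (swap G) ,
  equidistribution G (latticePointsᴱ G) (latticePointsᴱ (swap G))
    (Q⇒LatticeHall G) (LatticeHall⇒Q G) (Q⇒LatticeHall (swap G)) (LatticeHall⇒Q (swap G))
  where
  open Combinatorics
  open Geometry K
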